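{- Let $d\ge 1$ be an integer. For every finite (nonempty, simple) $d$-regular graph $G$ and every real $\lambda>0$, \[ \alpha_G(\lambda)\;\le\;\alpha_{K_{d,d}}(\lambda)\;=\;\frac{\lambda(1+\lambda)^{d-1}}{2(1+\lambda)^d-1}, \] where $\alpha_G(\lambda)$ is the occupancy fraction of the hard-core model on $G$ at fugacity $\lambda$. Moreover, the maximum is achieved only by disjoint unions of copies of $K_{d,d}$: if for some $\lambda>0$ equality holds, then $G$ is a disjoint union of copies of $K_{d,d}$.
   Context: For a finite graph $G$, let $\mathcal I$ be the set of all independent sets of $G$ (including the empty set), and let $P_G(\lambda)=\sum_{I\in\mathcal I}\lambda^{|I|}$ be the independence polynomial. The hard-core model with fugacity $\lambda$ on $G$ is the random independent set $I$ with $\Pr[I]=\lambda^{|I|}/P_G(\lambda)$. The occupancy fraction is the expected fraction of vertices of $G$ belonging to $I$: \[ \alpha_G(\lambda)=\frac{1}{|V(G)|}\sum_{v\in V(G)}\Pr[v\in I]=\frac{1}{|V(G)|}\frac{\lambda P_G'(\lambda)}{P_G(\lambda)}. \] $K_{d,d}$ denotes the complete bipartite graph with $d$ vertices in each part. -}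

module Defs where

open import Level using (Level; 0ℓ; _⊔_) renaming (suc to lsuc)
open import Algebra.Apartness.Bundles using (HeytingField; HeytingCommutativeRing)
open import Algebra.Bundles using (CommutativeRing; Semiring)
import Algebra.Apartness.Properties.HeytingCommutativeRing as HCRProperties
import Algebra.Properties.Ring as RingProperties
import Algebra.Definitions.RawSemiring as RawSemiringDefs
open import Data.Empty using (⊥)
open import Data.Fin.Base using (Fin; splitAt; quotient; remainder)
open import Data.Fin.Properties using (all?; _≟_)
open import Data.Fin.Subset using (Subset; inside; outside; _∈_; ∣_∣) renaming (⊥ to ∅)
open import Data.Fin.Subset.Properties using (_∈?_; ∉⊥)
open import Data.List.Base using (List; []; _∷_; map; foldr; filter; length; _++_; allFin)
open import Data.List.Membership.Propositional using () renaming (_∈_ to _∈ˡ_)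
open import Data.List.Membership.Propositional.Properties using (∈-++⁺ˡ; ∈-map⁺; ∈-filter⁺)
open import Data.List.Relation.Unary.Any using (here; there)
open import Data.Nat.Base as ℕ using (ℕ; zero; suc; NonZero)
open import Data.Product.Base using (∃-syntax; _×_; _,_; proj₁; proj₂)
open import Data.Sum.Base using (_⊎_; inj₁; inj₂)
open import Data.Unit.Base using (⊤; tt)
open import Data.Vec.Base using ([]; _∷_)
open import Function.Bundles using (_↔_; _⇔_; Inverse; Equivalence)
open import Relation.Binary.Core using (Rel)
open import Relation.Binary.Definitions using (Decidable; Symmetric; Irreflexive)
open import Relation.Binary.PropositionalEquality.Core using (_≡_; refl) renaming (sym to ≡-sym)
open import Relation.Binary.Structures using (IsStrictPartialOrder)
open import Relation.Nullary using (¬_; Dec; yes; no; ¬?)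
open import Relation.Nullary.Decidable using (_→-dec_; _×-dec_)

-- The library has no real numbers, so they are characterised as the
-- Archimedean, Cauchy-complete ordered field, which determines them up to
-- isomorphism.  The order is not assumed decidable, so the Cauchy reals
-- over ℚ are a model in Agda; in classical mathematics, ℝ is.

record Reals c ℓ₁ ℓ₂ : Set (lsuc (c ⊔ ℓ₁ ⊔ ℓ₂)) where
  infix 4 _<_ _≤_
  field
    heytingField : HeytingField c ℓ₁ ℓ₂

  open HeytingField heytingField public

  commutativeRing : CommutativeRing c ℓ₁
  commutativeRing = HeytingCommutativeRing.commutativeRing heytingCommutativeRing

  open RawSemiringDefs (Semiring.rawSemiring (CommutativeRing.semiring commutativeRing)) public
    using (_^_) renaming (_×_ to infixr 8 _·_)

  field
    _<_                  : Rel Carrier ℓ₂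
    isStrictPartialOrder : IsStrictPartialOrder _≈_ _<_
    #⇔<⊎>                : ∀ {x y} → x # y ⇔ (x < y ⊎ y < x)
    +-monoˡ-<            : ∀ {x y} z → x < y → x + z < y + z
    *-pos                : ∀ {x y} → 0# < x → 0# < y → 0# < x * y

  _≤_ : Rel Carrier ℓ₂
  x ≤ y = ¬ (y < x)

  -- The bound ∣ a - b ∣ < ε is written a < b + ε and b < a + ε; for Cauchy
  -- sequences one half suffices, by exchanging m and n.
  Cauchy : (ℕ → Carrier) → Set (c ⊔ ℓ₂)
  Cauchy s = ∀ ε → 0# < ε → ∃[ N ] (∀ m n → N ℕ.≤ m → N ℕ.≤ n → s m < s n + ε)

  _⟶_ : (ℕ → Carrier) → Carrier → Set (c ⊔ ℓ₂)
  s ⟶ x = ∀ ε → 0# < ε → ∃[ N ] (∀ n → N ℕ.≤ n → s n < x + ε × x < s n + ε)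

  field
    archimedean : ∀ x → ∃[ n ] x < n · 1#
    complete    : ∀ s → Cauchy s → ∃[ x ] s ⟶ x

  open IsStrictPartialOrder isStrictPartialOrder public
    using (<-respʳ-≈; <-respˡ-≈) renaming (irrefl to <-irrefl; trans to <-trans)

record Graph (n : ℕ) : Set₁ where
  field
    Adj        : Rel (Fin n) 0ℓ
    adj?       : Decidable Adj
    adj-sym    : Symmetric Adj
    adj-irrefl : Irreflexive _≡_ Adj

open Graph

degree : ∀ {n} → Graph n → Fin n → ℕ
degree {n} G v = length (filter (adj? G v) (allFin n))

Regular : ∀ {n} → ℕ → Graph n → Set
Regular d G = ∀ v → degree G v ≡ d

infix 4 _≅_

record _≅_ {m n} (G : Graph m) (H : Graph n) : Set where
  field
    bijection : Fin m ↔ Fin n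
    adj⇔adj   : ∀ u v → Adj G u v ⇔
                Adj H (Inverse.to bijection u) (Inverse.to bijection v)

-- Adjacency in a complete bipartite graph with parts A and B.
Opposite : {A B : Set} → Rel (A ⊎ B) 0ℓ
Opposite (inj₁ _) (inj₁ _) = ⊥
Opposite (inj₁ _) (inj₂ _) = ⊤
Opposite (inj₂ _) (inj₁ _) = ⊤
Opposite (inj₂ _) (inj₂ _) = ⊥

opposite? : {A B : Set} → Decidable (Opposite {A} {B})
opposite? (inj₁ _) (inj₁ _) = no λ ()
opposite? (inj₁ _) (inj₂ _) = yes tt
opposite? (inj₂ _) (inj₁ _) = yes tt
opposite? (inj₂ _) (inj₂ _) = no λ ()

opposite-sym : {A B : Set} → Symmetric (Opposite {A} {B})
opposite-sym {x = inj₁ _} {inj₂ _} _ = tt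
opposite-sym {x = inj₂ _} {inj₁ _} _ = tt

opposite-irrefl : {A B : Set} (x : A ⊎ B) → ¬ Opposite x x
opposite-irrefl (inj₁ _) ()
opposite-irrefl (inj₂ _) ()

-- K_{d,d}: the parts are the first d and the last d vertices.
K : (d : ℕ) → Graph (d ℕ.+ d)
K d = record
  { Adj        = λ u v → Opposite (splitAt d u) (splitAt d v)
  ; adj?       = λ u v → opposite? (splitAt d u) (splitAt d v)
  ; adj-sym    = λ {u} {v} → opposite-sym {x = splitAt d u} {splitAt d v}
  ; adj-irrefl = λ { {u} refl → opposite-irrefl (splitAt d u) }
  }

-- The disjoint union of k copies of G: a vertex of Fin (k * n) stands for a
-- pair (copy, vertex of G) under Fin (k * n) ≃ Fin k × Fin n.
copies : ∀ {n} (k : ℕ) → Graph n → Graph (k ℕ.* n)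
copies {n} k G = record
  { Adj        = λ u v → copy u ≡ copy v × Adj G (vertex u) (vertex v)
  ; adj?       = λ u v → (copy u ≟ copy v) ×-dec adj? G (vertex u) (vertex v)
  ; adj-sym    = λ (p , q) → ≡-sym p , adj-sym G q
  ; adj-irrefl = λ { refl (_ , q) → adj-irrefl G refl q }
  }
  where
  copy : Fin (k ℕ.* n) → Fin k
  copy = quotient n

  vertex : Fin (k ℕ.* n) → Fin n
  vertex = remainder {k} n

instance
  d+d≢0 : ∀ {d} .{{_ : NonZero d}} → NonZero (d ℕ.+ d)
  d+d≢0 {suc _} = _

Independent : ∀ {n} → Graph n → Subset n → Set
Independent G I = ∀ u v → u ∈ I → v ∈ I → ¬ Adj G u v

independent? : ∀ {n} (G : Graph n) (I : Subset n) → Dec (Independent G I)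
independent? G I =
  all? λ u → all? λ v → (u ∈? I) →-dec ((v ∈? I) →-dec ¬? (adj? G u v))

allSubsets : ∀ n → List (Subset n)
allSubsets zero    = [] ∷ []
allSubsets (suc n) = map (outside ∷_) (allSubsets n) ++ map (inside ∷_) (allSubsets n)

independentSets : ∀ {n} → Graph n → List (Subset n)
independentSets {n} G = filter (independent? G) (allSubsets n)

∅∈allSubsets : ∀ n → ∅ ∈ˡ allSubsets n
∅∈allSubsets zero    = here refl
∅∈allSubsets (suc n) = ∈-++⁺ˡ (∈-map⁺ (outside ∷_) (∅∈allSubsets n))

∅∈independentSets : ∀ {n} (G : Graph n) → ∅ ∈ˡ independentSets G
∅∈independentSets {n} G =
  ∈-filter⁺ (independent? G) (∅∈allSubsets n) (λ _ _ u∈∅ _ _ → ∉⊥ u∈∅)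

module HardCore {c ℓ₁ ℓ₂} (ℝ : Reals c ℓ₁ ℓ₂) where

  open Reals ℝ renaming (refl to ≈-refl; sym to ≈-sym; trans to ≈-trans)

  private
    module R = CommutativeRing commutativeRing
    open RingProperties R.ring using (-‿distribˡ-*; -‿involutive)

  infixl 7 _÷_⟨_⟩

  -- The library's inverse of an element apart from 0# is that of y - 0#.
  _÷_⟨_⟩ : ∀ (x y : Carrier) → 0# < y → Carrier
  x ÷ y ⟨ y>0 ⟩ = x * proj₁ (#⇒invertible (Equivalence.from #⇔<⊎> (inj₂ y>0)))

  ∑ : {A : Set} → List A → (A → Carrier) → Carrier
  ∑ xs f = foldr _+_ 0# (map f xs)

  private
    x<y+x : ∀ {x y} → 0# < y → x < y + x
    x<y+x {x} y>0 = <-respˡ-≈ (R.+-identityˡ x) (+-monoˡ-< x y>0)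

  +-pos : ∀ {x y} → 0# < x → 0# < y → 0# < x + y
  +-pos x>0 y>0 = <-trans y>0 (x<y+x x>0)

  1>0 : 0# < 1#
  1>0 with Equivalence.to #⇔<⊎> (HCRProperties.1#0 heytingCommutativeRing)
  ... | inj₂ 0<1 = 0<1
  ... | inj₁ 1<0 = <-respʳ-≈ [-1]²≈1 (*-pos -1>0 -1>0)
    where
    -1>0 : 0# < - 1#
    -1>0 = <-respˡ-≈ (R.-‿inverseʳ 1#) (<-respʳ-≈ (R.+-identityˡ (- 1#)) (+-monoˡ-< (- 1#) 1<0))

    [-1]²≈1 : - 1# * - 1# ≈ 1#
    [-1]²≈1 = ≈-trans (≈-sym (-‿distribˡ-* 1# (- 1#)))
             (≈-trans (R.-‿cong (R.*-identityˡ (- 1#))) (-‿involutive 1#))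

  ^-pos : ∀ {x} n → 0# < x → 0# < x ^ n
  ^-pos zero    x>0 = 1>0
  ^-pos (suc n) x>0 = *-pos x>0 (^-pos n x>0)

  ·1-pos : ∀ n .{{_ : NonZero n}} → 0# < n · 1#
  ·1-pos (suc zero)    = <-respʳ-≈ (≈-sym (R.+-identityʳ 1#)) 1>0
  ·1-pos (suc (suc n)) = +-pos 1>0 (·1-pos (suc n))

  ∑-pos : {A : Set} {f : A → Carrier} → (∀ x → 0# < f x) →
          ∀ {x xs} → x ∈ˡ xs → 0# < ∑ xs f
  ∑-pos f>0 {xs = x ∷ []}     _ = <-respʳ-≈ (≈-sym (R.+-identityʳ _)) (f>0 x)
  ∑-pos f>0 {xs = x ∷ y ∷ ys} _ = +-pos (f>0 x) (∑-pos f>0 {xs = y ∷ ys} (here refl))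

  2[1+x]^d-1>0 : ∀ d {x} → 0# < x → 0# < (1# + 1#) * (1# + x) ^ d - 1#
  2[1+x]^d-1>0 d {x} x>0 =
    <-respˡ-≈ (R.-‿inverseʳ 1#) (+-monoˡ-< (- 1#) (1<2[1+x]^ d))
    where
    2>0 : 0# < 1# + 1#
    2>0 = +-pos 1>0 1>0

    1+x>0 : 0# < 1# + x
    1+x>0 = +-pos 1>0 x>0

    1<2[1+x]^ : ∀ n → 1# < (1# + 1#) * (1# + x) ^ n
    1<2[1+x]^ zero    = <-respʳ-≈ (≈-sym (R.*-identityʳ _)) (x<y+x 1>0)
    1<2[1+x]^ (suc n) = <-respʳ-≈ (≈-sym 2[1+x]p≈)
      (<-trans (1<2[1+x]^ n) (x<y+x (*-pos x>0 (*-pos 2>0 (^-pos n 1+x>0)))))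
      where
      p = (1# + x) ^ n
      2[1+x]p≈ : (1# + 1#) * ((1# + x) * p) ≈ x * ((1# + 1#) * p) + (1# + 1#) * p
      2[1+x]p≈ = ≈-trans (≈-sym (R.*-assoc _ _ _))
            (≈-trans (R.*-congʳ (R.*-comm _ _))
            (≈-trans (R.*-assoc _ _ _)
            (≈-trans (R.distribʳ _ _ _)
            (≈-trans (R.+-congʳ (R.*-identityˡ _)) (R.+-comm _ _)))))

  independencePoly : ∀ {n} → Graph n → Carrier → Carrier
  independencePoly G x = ∑ (independentSets G) (λ I → x ^ ∣ I ∣)

  independencePoly-pos : ∀ {n} (G : Graph n) {x} → 0# < x → 0# < independencePoly G x
  independencePoly-pos G x>0 = ∑-pos (λ I → ^-pos ∣ I ∣ x>0) (∅∈independentSets G)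

  Pr : ∀ {n} (G : Graph n) {x} → 0# < x → Subset n → Carrier
  Pr G {x} x>0 I = x ^ ∣ I ∣ ÷ independencePoly G x ⟨ independencePoly-pos G x>0 ⟩

  Pr[_∈I] : ∀ {n} → Fin n → (G : Graph n) → ∀ {x} → 0# < x → Carrier
  Pr[ v ∈I] G x>0 = ∑ (filter (v ∈?_) (independentSets G)) (Pr G x>0)

  -- In Pr and here, x is the fugacity.
  occupancyFraction : ∀ {n} .{{_ : NonZero n}} (G : Graph n) {x} → 0# < x → Carrier
  occupancyFraction {n} G x>0 = ∑ (allFin n) (λ v → Pr[ v ∈I] G x>0) ÷ n · 1# ⟨ ·1-pos n ⟩

{-# OPTIONS --safe #-}

-- For fugacity x, let W(φ) be the total weight of the independent sets satisfying
-- φ, let Z be that of all of them, q = 1 + x, X(u) = W(u ∈ I) and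
-- Y(v) = W(N(v) ∩ I = ∅).  Adding v to the sets that avoid v and N(v) gives
-- q X(v) = x Y(v).
--
-- Enumerate N(v) cyclically as e(0), e(1), … with period d.  Splitting off the
-- first e(s + j) that belongs to I gives, for every s,
--   Z - Y(v) = ∑_{j<d} W(e(s + j) ∈ I and e(s), …, e(s + j - 1) ∉ I).
-- Removing a vertex from independent sets shows that the j-th summand is at
-- least q^(-j) X(e(s + j)).  Summing over s makes every neighbour occur once at
-- each j, so that
--   (q^d - 1) ∑_{u ∈ N(v)} X(u) ≤ d x q^(d-1) (Z - Y(v)),
-- and summing over v, with double counting on the left, gives the bound.
--
-- All steps are equalities if the neighbours of each vertex have the same
-- neighbourhoods, as in K_{d,d}.  Conversely, equality for j = 1 forces
-- N(e(s)) ⊆ N(e(s + 1)): for w adjacent to e(s) but not to e(s + 1), nothing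
-- compensates {e(s + 1), w}, to which e(s) cannot be added.  Going round the
-- cycle, all neighbours of v have the same neighbourhoods; then N(v) and N(u),
-- for any neighbour u of v, are the two parts of a component K_{d,d}.

module Submission where

open import Defs
open Graph
open import Level using (_⊔_)
open import Algebra.Bundles using (CommutativeRing)
import Algebra.Properties.AbelianGroup as AbelianGroupProperties
import Algebra.Solver.Ring.NaturalCoefficients.Default as NatCoefficients
open import Data.Bool.Base using (Bool; true; false; if_then_else_; not; _∧_)
open import Data.Bool.Properties using (∧-assoc; ∧-identityʳ)
open import Data.Fin.Base
  using (Fin; zero; suc; toℕ; fromℕ<; splitAt; join; quotient; remainder; combine; _↑ˡ_; _↑ʳ_)
open import Data.Fin.Properties
  using ( _≟_; all?; any?; ¬∀⟶∃¬; toℕ-injective; toℕ<n; toℕ-fromℕ<; injective⇒≤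
        ; splitAt-↑ˡ; splitAt-↑ʳ; splitAt-join; join-splitAt; remQuot-combine; combine-remQuot)
open import Data.Fin.Subset using (Subset; inside; outside; _∈_; _∉_; ∣_∣; ⊥)
open import Data.Fin.Subset.Properties using (_∈?_; ∉⊥)
open import Data.List.Base
  using (List; []; _∷_; map; filter; length; _++_; downFrom; allFin; lookup; tabulate)
open import Data.List.Membership.Propositional using () renaming (_∈_ to _∈ˡ_)
open import Data.List.Membership.Propositional.Properties
  using (∈-++⁺ˡ; ∈-++⁺ʳ; ∈-map⁺; ∈-lookup; ∈-downFrom⁺; ∈-filter⁻; ∈-filter⁺; ∈-allFin)
open import Data.List.Properties
  using (length-downFrom; length-tabulate; length-++; filter-++; filter-all; filter-none)
open import Data.List.Relation.Unary.All as All using ()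
open import Data.List.Relation.Unary.All.Properties using (tabulate⁺)
open import Data.List.Relation.Unary.AllPairs using (_∷_)
open import Data.List.Relation.Unary.Any as Any using (here; there)
open import Data.List.Relation.Unary.Any.Properties using (lookup-index)
open import Data.List.Relation.Unary.Unique.Propositional using (Unique)
open import Data.List.Relation.Unary.Unique.Propositional.Properties using (allFin⁺; filter⁺)
open import Data.Nat.Base as ℕ using (ℕ; zero; suc; pred; NonZero; z<s; s<s; _%_)
open import Data.Nat.DivMod using (_mod_; [m+n]%n≡m%n; m<n⇒m%n≡m; m%n<n)
import Data.Nat.Properties as ℕₚ
open import Data.Product.Base using (∃-syntax; _×_; _,_; proj₁; proj₂)
open import Data.Sum.Base using (_⊎_; inj₁; inj₂)
open import Data.Unit.Base using (⊤; tt)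
open import Data.Vec.Base using ([]; _∷_; _[_]≔_; here; there)
open import Data.Vec.Properties using ([]≔-updates; []≔-minimal; lookup∘update′; lookup⇒[]=; []=⇒lookup)
open import Function.Base using (_∘_; const; id)
open import Function.Bundles using (_⇔_; mk⇔; mk↔ₛ′; Equivalence)
open import Relation.Binary.Core using (Rel)
open import Relation.Binary.Definitions using (tri<; tri≈; tri>)
open import Relation.Binary.PropositionalEquality.Core
  using (_≡_; _≢_; refl; sym; trans; cong; cong₂; subst; subst₂)
import Relation.Binary.Reasoning.Setoid as SetoidReasoning
open import Relation.Nullary using (¬_; Dec; does; yes; no; ¬?; contradiction)
open import Relation.Nullary.Decidable using (_×-dec_; _→-dec_)

-- Ordered-field arithmetic, finite sums and indicator weights.

module Ordered {c ℓ₁ ℓ₂} (ℝ : Reals c ℓ₁ ℓ₂) where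

  open Reals ℝ renaming (refl to ≈-refl; sym to ≈-sym; trans to ≈-trans; reflexive to ≈-reflexive)
  open HardCore ℝ
  open CommutativeRing commutativeRing using (commutativeSemiring; +-abelianGroup)
  open AbelianGroupProperties +-abelianGroup using (∙-cancelˡ)
  open NatCoefficients commutativeSemiring using (solve; _:=_; _:+_; _:*_)
  open SetoidReasoning setoid

  infix 4 _≼_

  -- Unlike _≤_, this relation tells which of the two cases holds.
  _≼_ : Rel Carrier (ℓ₁ ⊔ ℓ₂)
  x ≼ y = x < y ⊎ x ≈ y

  +-monoʳ-< : ∀ {x y} z → x < y → z + x < z + y
  +-monoʳ-< z x<y = <-respˡ-≈ (+-comm _ _) (<-respʳ-≈ (+-comm _ _) (+-monoˡ-< z x<y))

  +-mono-<-≼ : ∀ {x y u v} → x < y → u ≼ v → x + u < y + v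
  +-mono-<-≼ x<y (inj₁ u<v) = <-trans (+-monoˡ-< _ x<y) (+-monoʳ-< _ u<v)
  +-mono-<-≼ x<y (inj₂ u≈v) = <-respʳ-≈ (+-congˡ u≈v) (+-monoˡ-< _ x<y)

  *-monoˡ-< : ∀ {x y z} → 0# < z → x < y → z * x < z * y
  *-monoˡ-< {x} {y} {z} z>0 x<y =
    <-respˡ-≈ (+-identityʳ _) (<-respʳ-≈ zx+z[y-x]≈zy (+-monoʳ-< (z * x) (*-pos z>0 y-x>0)))
    where
    y-x>0 : 0# < y + - x
    y-x>0 = <-respˡ-≈ (-‿inverseʳ x) (+-monoˡ-< (- x) x<y)

    zx+z[y-x]≈zy : z * x + z * (y + - x) ≈ z * y
    zx+z[y-x]≈zy = begin
      z * x + z * (y + - x)  ≈⟨ solve 4 (λ z x y x′ → z :* x :+ z :* (y :+ x′) := z :* (y :+ (x :+ x′))) ≈-refl z x y (- x) ⟩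
      z * (y + (x + - x))    ≈⟨ *-congˡ (+-congˡ (-‿inverseʳ x)) ⟩
      z * (y + 0#)           ≈⟨ *-congˡ (+-identityʳ y) ⟩
      z * y                  ∎

  ≼⇒≤ : ∀ {x y} → x ≼ y → x ≤ y
  ≼⇒≤ (inj₁ x<y) y<x = <-irrefl ≈-refl (<-trans x<y y<x)
  ≼⇒≤ (inj₂ x≈y) y<x = <-irrefl (≈-sym x≈y) y<x

  recip : ∀ y → 0# < y → Carrier
  recip y y>0 = proj₁ (#⇒invertible (Equivalence.from #⇔<⊎> (inj₂ y>0)))

  x-0≈x : ∀ x → x + - 0# ≈ x
  x-0≈x x = ≈-trans (≈-sym (+-identityʳ _)) (≈-trans (+-assoc _ _ _) (≈-trans (+-congˡ (-‿inverseˡ 0#)) (+-identityʳ x)))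

  recip-inverseˡ : ∀ {y} (y>0 : 0# < y) → recip y y>0 * y ≈ 1#
  recip-inverseˡ {y} y>0 = ≈-trans (*-congˡ (≈-sym (x-0≈x y)))
    (proj₁ (proj₂ (#⇒invertible (Equivalence.from #⇔<⊎> (inj₂ y>0)))))

  -- An invertible element is apart from 0, and apartness decides its sign; multiplying a negative
  -- reciprocal by `y` would give `1# < 0#`.
  recip-pos : ∀ {y} (y>0 : 0# < y) → 0# < recip y y>0
  recip-pos {y} y>0 with Equivalence.to #⇔<⊎> (invertible⇒# {recip y y>0} {0#} (y , yr≈1 , ry≈1))
    where
    ry≈1 : (recip y y>0 + - 0#) * y ≈ 1#
    ry≈1 = ≈-trans (*-congʳ (x-0≈x _)) (recip-inverseˡ y>0)

    yr≈1 : y * (recip y y>0 + - 0#) ≈ 1#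
    yr≈1 = ≈-trans (*-comm _ _) ry≈1
  ... | inj₂ 0<r = 0<r
  ... | inj₁ r<0 = contradiction (<-trans 1>0 1<0) (<-irrefl ≈-refl)
    where
    1<0 : 1# < 0#
    1<0 = <-respˡ-≈ (≈-trans (*-comm _ _) (recip-inverseˡ y>0)) (<-respʳ-≈ (zeroʳ y) (*-monoˡ-< y>0 r<0))

  -- The estimates are proved for any such relation: ≼ gives the bound, and ≈ the
  -- value that graphs with twin neighbours attain.
  record OrderLike {ℓ} (_∼_ : Rel Carrier ℓ) : Set (c ⊔ ℓ₁ ⊔ ℓ₂ ⊔ ℓ) where
    field
      ≈⇒∼     : ∀ {x y} → x ≈ y → x ∼ y
      ∼-trans : ∀ {x y z} → x ∼ y → y ∼ z → x ∼ z
      +-mono  : ∀ {x y u v} → x ∼ y → u ∼ v → (x + u) ∼ (y + v)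
      *-mono  : ∀ {x y z} → 0# < z → x ∼ y → (z * x) ∼ (z * y)

    ∼-resp : ∀ {x x′ y y′} → x ≈ x′ → y ≈ y′ → x ∼ y → x′ ∼ y′
    ∼-resp x≈x′ y≈y′ x∼y = ∼-trans (≈⇒∼ (≈-sym x≈x′)) (∼-trans x∼y (≈⇒∼ y≈y′))

    *-cancel : ∀ {x y z} → 0# < z → (z * x) ∼ (z * y) → x ∼ y
    *-cancel {z = z} z>0 = ∼-resp (cancel _) (cancel _) ∘ *-mono (recip-pos z>0)
      where
      cancel : ∀ x → recip z z>0 * (z * x) ≈ x
      cancel x = ≈-trans (≈-sym (*-assoc _ _ _)) (≈-trans (*-congʳ (recip-inverseˡ z>0)) (*-identityˡ x))

    ∑-mono : {A : Set} (xs : List A) {f g : A → Carrier} → (∀ x → f x ∼ g x) → ∑ xs f ∼ ∑ xs g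
    ∑-mono []       f∼g = ≈⇒∼ ≈-refl
    ∑-mono (x ∷ xs) f∼g = +-mono (f∼g x) (∑-mono xs f∼g)

  ≈-orderLike : OrderLike _≈_
  ≈-orderLike = record
    { ≈⇒∼ = id ; ∼-trans = ≈-trans ; +-mono = +-cong ; *-mono = λ _ → *-congˡ }

  ≼-orderLike : OrderLike _≼_
  ≼-orderLike = record { ≈⇒∼ = inj₂ ; ∼-trans = ≼-trans ; +-mono = +-mono-≼ ; *-mono = *-monoˡ-≼ }
    where
    ≼-trans : ∀ {x y z} → x ≼ y → y ≼ z → x ≼ z
    ≼-trans (inj₁ x<y) (inj₁ y<z) = inj₁ (<-trans x<y y<z)
    ≼-trans (inj₁ x<y) (inj₂ y≈z) = inj₁ (<-respʳ-≈ y≈z x<y)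
    ≼-trans (inj₂ x≈y) (inj₁ y<z) = inj₁ (<-respˡ-≈ (≈-sym x≈y) y<z)
    ≼-trans (inj₂ x≈y) (inj₂ y≈z) = inj₂ (≈-trans x≈y y≈z)

    +-mono-≼ : ∀ {x y u v} → x ≼ y → u ≼ v → x + u ≼ y + v
    +-mono-≼ (inj₁ x<y) u≼v        = inj₁ (+-mono-<-≼ x<y u≼v)
    +-mono-≼ (inj₂ x≈y) (inj₁ u<v) = inj₁ (<-respʳ-≈ (+-congʳ x≈y) (+-monoʳ-< _ u<v))
    +-mono-≼ (inj₂ x≈y) (inj₂ u≈v) = inj₂ (+-cong x≈y u≈v)

    *-monoˡ-≼ : ∀ {x y z} → 0# < z → x ≼ y → z * x ≼ z * y
    *-monoˡ-≼ z>0 (inj₁ x<y) = inj₁ (*-monoˡ-< z>0 x<y)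
    *-monoˡ-≼ z>0 (inj₂ x≈y) = inj₂ (*-congˡ x≈y)

  open OrderLike ≈-orderLike public using () renaming (∑-mono to ∑-cong; *-cancel to *-cancel-≈)
  open OrderLike ≼-orderLike public using () renaming (∑-mono to ∑-mono-≼)

  -- A strict first inequality would make the sums strictly ordered, and `≼` tells whether it is
  -- strict. In this way an equality of sums is passed down to the summands.
  +-equalˡ : ∀ {x y u v} → x ≼ y → u ≼ v → x + u ≈ y + v → x ≈ y
  +-equalˡ (inj₂ x≈y) _   _  = x≈y
  +-equalˡ (inj₁ x<y) u≼v eq = contradiction (+-mono-<-≼ x<y u≼v) (<-irrefl eq)

  +-equalʳ : ∀ {x y u v} → x ≼ y → u ≼ v → x + u ≈ y + v → u ≈ v
  +-equalʳ x≼y u≼v eq = +-equalˡ u≼v x≼y (≈-trans (+-comm _ _) (≈-trans eq (+-comm _ _)))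

  ∑-equal : {A : Set} (xs : List A) {f g : A → Carrier} → (∀ x → f x ≼ g x) →
            ∑ xs f ≈ ∑ xs g → ∀ {x} → x ∈ˡ xs → f x ≈ g x
  ∑-equal (x ∷ xs) f≼g eq (here refl) = +-equalˡ (f≼g x) (∑-mono-≼ xs f≼g) eq
  ∑-equal (x ∷ xs) f≼g eq (there x∈)  = ∑-equal xs f≼g (+-equalʳ (f≼g x) (∑-mono-≼ xs f≼g) eq) x∈

  ∑-0 : {A : Set} (xs : List A) → ∑ xs (const 0#) ≈ 0#
  ∑-0 []       = ≈-refl
  ∑-0 (x ∷ xs) = ≈-trans (+-identityˡ _) (∑-0 xs)

  ∑-const : {A : Set} (xs : List A) (y : Carrier) → ∑ xs (const y) ≈ (length xs · 1#) * y
  ∑-const []       y = ≈-sym (zeroˡ y)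
  ∑-const (x ∷ xs) y = ≈-trans (+-cong (≈-sym (*-identityˡ y)) (∑-const xs y)) (≈-sym (distribʳ y 1# _))

  ∑-+ : {A : Set} (xs : List A) (f g : A → Carrier) → ∑ xs (λ x → f x + g x) ≈ ∑ xs f + ∑ xs g
  ∑-+ []       f g = ≈-sym (+-identityˡ 0#)
  ∑-+ (x ∷ xs) f g = ≈-trans (+-congˡ (∑-+ xs f g))
    (solve 4 (λ a b c d → (a :+ b) :+ (c :+ d) := (a :+ c) :+ (b :+ d)) ≈-refl _ _ _ _)

  ∑-*ˡ : {A : Set} (xs : List A) (y : Carrier) (f : A → Carrier) → ∑ xs (λ x → y * f x) ≈ y * ∑ xs f
  ∑-*ˡ []       y f = ≈-sym (zeroʳ y)
  ∑-*ˡ (x ∷ xs) y f = ≈-trans (+-congˡ (∑-*ˡ xs y f)) (≈-sym (distribˡ y _ _))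

  ∑-++ : {A : Set} (xs ys : List A) (f : A → Carrier) → ∑ (xs ++ ys) f ≈ ∑ xs f + ∑ ys f
  ∑-++ []       ys f = ≈-sym (+-identityˡ _)
  ∑-++ (x ∷ xs) ys f = ≈-trans (+-congˡ (∑-++ xs ys f)) (≈-sym (+-assoc _ _ _))

  ∑-map : {A B : Set} (h : A → B) (xs : List A) (f : B → Carrier) → ∑ (map h xs) f ≡ ∑ xs (f ∘ h)
  ∑-map h []       f = refl
  ∑-map h (x ∷ xs) f = cong (_ +_) (∑-map h xs f)

  ∑-swap : {A B : Set} (xs : List A) (ys : List B) (f : A → B → Carrier) →
           ∑ xs (λ x → ∑ ys (f x)) ≈ ∑ ys (λ y → ∑ xs (λ x → f x y))
  ∑-swap []       ys f = ≈-sym (∑-0 ys)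
  ∑-swap (x ∷ xs) ys f = ≈-trans (+-congˡ (∑-swap xs ys f)) (≈-sym (∑-+ ys _ _))

  guard : Bool → Carrier → Carrier
  guard b y = if b then y else 0#

  guard-cong : ∀ b {y z} → y ≈ z → guard b y ≈ guard b z
  guard-cong true  y≈z = y≈z
  guard-cong false _   = ≈-refl

  guard-* : ∀ b x y → x * guard b y ≈ guard b (x * y)
  guard-* true  x y = ≈-refl
  guard-* false x y = zeroʳ x

  guard-∧ : ∀ a b y → guard a (guard b y) ≡ guard (a ∧ b) y
  guard-∧ true  b y = refl
  guard-∧ false b y = refl

  guard-split : ∀ a b y → guard a y ≈ guard (a ∧ b) y + guard (a ∧ not b) y
  guard-split true  true  y = ≈-sym (+-identityʳ y)
  guard-split true  false y = ≈-sym (+-identityˡ y)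
  guard-split false _     y = ≈-sym (+-identityˡ 0#)

  -- As both conditions are decided, the case of `≼` is known: strict only when `Q` holds and `P`
  -- fails.
  guard-⇒ : ∀ {P Q : Set} (P? : Dec P) (Q? : Dec Q) {y} → 0# < y → (P → Q) →
            guard (does P?) y ≼ guard (does Q?) y
  guard-⇒ (yes p) (yes q) y>0 P⇒Q = inj₂ ≈-refl
  guard-⇒ (yes p) (no ¬q) y>0 P⇒Q = contradiction (P⇒Q p) ¬q
  guard-⇒ (no ¬p) (yes q) y>0 P⇒Q = inj₁ y>0
  guard-⇒ (no ¬p) (no ¬q) y>0 P⇒Q = inj₂ ≈-refl

  guard-⇔ : ∀ {P Q : Set} (P? : Dec P) (Q? : Dec Q) {y} → (P → Q) → (Q → P) →
            guard (does P?) y ≈ guard (does Q?) y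
  guard-⇔ (yes p) (yes q) P⇒Q Q⇒P = ≈-refl
  guard-⇔ (yes p) (no ¬q) P⇒Q Q⇒P = contradiction (P⇒Q p) ¬q
  guard-⇔ (no ¬p) (yes q) P⇒Q Q⇒P = contradiction (Q⇒P q) ¬p
  guard-⇔ (no ¬p) (no ¬q) P⇒Q Q⇒P = ≈-refl

  guard-≈⇒ : ∀ {P Q : Set} (P? : Dec P) (Q? : Dec Q) {y} → 0# < y →
             guard (does P?) y ≈ guard (does Q?) y → Q → P
  guard-≈⇒ (yes p) Q?      y>0 eq q = p
  guard-≈⇒ (no ¬p) (yes _) y>0 eq q = contradiction y>0 (<-irrefl eq)
  guard-≈⇒ (no ¬p) (no ¬q) y>0 eq q = contradiction q ¬q

  ∑-filter : {A : Set} {P : A → Set} (P? : ∀ x → Dec (P x)) (xs : List A) (f : A → Carrier) →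
             ∑ (filter P? xs) f ≈ ∑ xs (λ x → guard (does (P? x)) (f x))
  ∑-filter P? []       f = ≈-refl
  ∑-filter P? (x ∷ xs) f with does (P? x)
  ... | true  = +-congˡ (∑-filter P? xs f)
  ... | false = ≈-trans (∑-filter P? xs f) (≈-sym (+-identityˡ _))

  -- The list `downFrom (suc k)` begins with `k`; shifting the index requires splitting off 0 at the
  -- other end.
  ∑-downFrom-suc : ∀ k (f : ℕ → Carrier) → ∑ (downFrom (suc k)) f ≈ f 0 + ∑ (downFrom k) (f ∘ suc)
  ∑-downFrom-suc zero    f = ≈-refl
  ∑-downFrom-suc (suc k) f = ≈-trans (+-congˡ (∑-downFrom-suc k f))
    (solve 3 (λ a b c → a :+ (b :+ c) := b :+ (a :+ c)) ≈-refl _ _ _)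

  -- Inserting `w` is a bijection from the subsets without `w` to those with it.
  ∑-toggle : ∀ {n} (w : Fin n) (f : Subset n → Carrier) →
             ∑ (allSubsets n) (λ I → guard (does (w ∈? I)) (f I)) ≈
             ∑ (allSubsets n) (λ I → guard (not (does (w ∈? I))) (f (I [ w ]≔ inside)))
  ∑-toggle {suc n} w f = ≈-trans (halves (with∈ w)) (≈-trans (step w) (≈-sym (halves (with∉ w))))
    where
    S = allSubsets n

    with∈ with∉ : Fin (suc n) → Subset (suc n) → Carrier
    with∈ w I = guard (does (w ∈? I)) (f I)
    with∉ w I = guard (not (does (w ∈? I))) (f (I [ w ]≔ inside))

    halves : (g : Subset (suc n) → Carrier) →
             ∑ (allSubsets (suc n)) g ≈ ∑ S (g ∘ (outside ∷_)) + ∑ S (g ∘ (inside ∷_))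
    halves g = ≈-trans (∑-++ (map (outside ∷_) S) _ g)
      (+-cong (≈-reflexive (∑-map _ S g)) (≈-reflexive (∑-map _ S g)))

    step : ∀ w → ∑ S (with∈ w ∘ (outside ∷_)) + ∑ S (with∈ w ∘ (inside ∷_)) ≈
                 ∑ S (with∉ w ∘ (outside ∷_)) + ∑ S (with∉ w ∘ (inside ∷_))
    -- One half vanishes on each side: the sets beginning with `outside` on the left, those
    -- beginning with `inside` on the right. The remaining halves coincide.
    step zero    = +-comm _ _
    step (suc w) = +-cong (∑-toggle w (f ∘ (outside ∷_))) (∑-toggle w (f ∘ (inside ∷_)))

  ∑-lookup : {A : Set} (L : List A) (g : ℕ → A) (f : A → Carrier) → (∀ i → g (toℕ i) ≡ lookup L i) →
             ∑ (downFrom (length L)) (f ∘ g) ≈ ∑ L f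
  ∑-lookup []       g f g≡lookup = ≈-refl
  ∑-lookup (a ∷ L) g f g≡lookup = ≈-trans (∑-downFrom-suc (length L) (f ∘ g))
    (+-cong (≈-reflexive (cong f (g≡lookup Fin.zero))) (∑-lookup L (g ∘ suc) f (g≡lookup ∘ suc)))

  -- Moving the window by one loses `f k` and gains `f (d + k)`, which periodicity makes equal.
  ∑-shift : ∀ {d} (f : ℕ → Carrier) → (∀ i → f (i ℕ.+ d) ≈ f i) →
            ∀ k → ∑ (downFrom d) (λ s → f (s ℕ.+ k)) ≈ ∑ (downFrom d) f
  ∑-shift {d} f periodic zero    = ∑-cong (downFrom d) λ s → ≈-reflexive (cong f (ℕₚ.+-identityʳ s))
  ∑-shift {d} f periodic (suc k) = ≈-trans (∑-cong (downFrom d) λ s → ≈-reflexive (cong f (ℕₚ.+-suc s k)))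
    (≈-trans (∙-cancelˡ (f k) _ _ (≈-trans (≈-sym (∑-downFrom-suc d (λ s → f (s ℕ.+ k)))) (+-congʳ fd+k≈fk)))
      (∑-shift f periodic k))
    where
    fd+k≈fk : f (d ℕ.+ k) ≈ f k
    fd+k≈fk = ≈-trans (≈-reflexive (cong f (ℕₚ.+-comm d k))) (periodic k)

  ÷-* : ∀ x {y} (y>0 : 0# < y) → (x ÷ y ⟨ y>0 ⟩) * y ≈ x
  ÷-* x y>0 = ≈-trans (*-assoc _ _ _) (≈-trans (*-congˡ (recip-inverseˡ y>0)) (*-identityʳ x))

-- Cyclic enumerations of lists.

lookup-injective : {A : Set} {L : List A} → Unique L → ∀ {i j} → lookup L i ≡ lookup L j → i ≡ j
lookup-injective (_  ∷ _) {zero}  {zero}  _  = refl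
lookup-injective (px ∷ _) {zero}  {suc j} eq = contradiction eq (All.lookup px (∈-lookup j))
lookup-injective (px ∷ _) {suc i} {zero}  eq = contradiction (sym eq) (All.lookup px (∈-lookup i))
lookup-injective (_  ∷ u) {suc i} {suc j} eq = cong suc (lookup-injective u eq)

-- Indices run through all of ℕ, so that a rotation is just the addition of a starting point.
-- Distinctness is asked of the first period only; the other windows inherit it.
record CyclicEnumeration {A : Set} (d : ℕ) (L : List A) : Set where
  field
    at          : ℕ → A
    length≡d    : length L ≡ d
    at≡lookup   : ∀ i → at (toℕ i) ≡ lookup L i
    at∈L        : ∀ i → at i ∈ˡ L
    periodic    : ∀ i → at (i ℕ.+ d) ≡ at i
    at-distinct : ∀ {i j} → i ℕ.< j → j ℕ.< d → at i ≢ at j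

  ∈⇒at : ∀ s {u} → u ∈ˡ L → ∃[ i ] i ℕ.< d × at (s ℕ.+ i) ≡ u
  ∈⇒at zero u∈L = toℕ (Any.index u∈L) , subst (toℕ (Any.index u∈L) ℕ.<_) length≡d (toℕ<n _) ,
    trans (at≡lookup _) (sym (lookup-index u∈L))
  ∈⇒at (suc s) u∈L with ∈⇒at s u∈L
  ... | suc i , i<d , eq = i , ℕₚ.<-trans (ℕₚ.n<1+n i) i<d , trans (cong at (sym (ℕₚ.+-suc s i))) eq
  -- The first element of the window starting at `s` is the last of the window starting at `suc s`,
  -- one period later.
  ... | zero  , 0<d , eq = pred d , pred[d]<d , trans (cong at 1+s+pred[d]≡s+d)
    (trans (periodic s) (trans (cong at (sym (ℕₚ.+-identityʳ s))) eq))
    where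
    1+pred[d]≡d : suc (pred d) ≡ d
    1+pred[d]≡d = ℕₚ.suc-pred d {{ℕ.>-nonZero 0<d}}

    pred[d]<d : pred d ℕ.< d
    pred[d]<d = ℕₚ.≤-reflexive 1+pred[d]≡d

    1+s+pred[d]≡s+d : suc s ℕ.+ pred d ≡ s ℕ.+ d
    1+s+pred[d]≡s+d = trans (sym (ℕₚ.+-suc s _)) (cong (s ℕ.+_) 1+pred[d]≡d)

  at-distinct-shifted : ∀ s {i j} → i ℕ.< j → j ℕ.< d → at (s ℕ.+ i) ≢ at (s ℕ.+ j)
  at-distinct-shifted zero    i<j j<d eq = at-distinct i<j j<d eq
  at-distinct-shifted (suc s) {i} {j} i<j j<d eq with ℕₚ.<-cmp (suc j) d
  ... | tri< 1+j<d _ _ = at-distinct-shifted s (s<s i<j) 1+j<d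
    (trans (cong at (ℕₚ.+-suc s i)) (trans eq (cong at (sym (ℕₚ.+-suc s j)))))
  ... | tri> _ _ d<1+j = contradiction j<d (ℕₚ.≤⇒≯ (ℕ.s≤s⁻¹ d<1+j))
  -- The last index wraps around: `suc s + j` is `s + d`, which has the value at `s`. The collision
  -- is thus one of positions `0` and `suc i` in the window starting at `s`.
  ... | tri≈ _ 1+j≡d _ = at-distinct-shifted s {0} {suc i} z<s (ℕₚ.<-≤-trans (s<s i<j) (ℕₚ.≤-reflexive 1+j≡d))
    (trans (cong at (ℕₚ.+-identityʳ s)) (trans (sym (periodic s))
      (trans (cong at s+d≡1+s+j) (trans (sym eq) (cong at (sym (ℕₚ.+-suc s i)))))))
    where
    s+d≡1+s+j : s ℕ.+ d ≡ suc s ℕ.+ j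
    s+d≡1+s+j = trans (cong (s ℕ.+_) (sym 1+j≡d)) (ℕₚ.+-suc s j)

cyclicEnumeration : {A : Set} {d : ℕ} .{{_ : NonZero d}} {L : List A} →
                    Unique L → length L ≡ d → CyclicEnumeration d L
cyclicEnumeration {L = L} unique refl = record
  { at          = λ i → lookup L (i mod d)
  ; length≡d    = refl
  ; at≡lookup   = λ i → cong (lookup L) (toℕ-injective (toℕ-mod-< (toℕ<n i)))
  ; at∈L        = λ i → ∈-lookup (i mod d)
  ; periodic    = λ i → cong (lookup L) (toℕ-injective
      (trans (toℕ-mod (i ℕ.+ d)) (trans ([m+n]%n≡m%n i d) (sym (toℕ-mod i)))))
  ; at-distinct = λ i<j j<d eq → ℕₚ.<⇒≢ i<j
      (trans (sym (toℕ-mod-< (ℕₚ.<-trans i<j j<d)))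
        (trans (cong toℕ (lookup-injective unique eq)) (toℕ-mod-< j<d)))
  }
  where
  d = length L

  toℕ-mod : ∀ i → toℕ (i mod d) ≡ i % d
  toℕ-mod i = toℕ-fromℕ< (m%n<n i d)

  toℕ-mod-< : ∀ {i} → i ℕ.< d → toℕ (i mod d) ≡ i
  toℕ-mod-< i<d = trans (toℕ-mod _) (m<n⇒m%n≡m i<d)

-- Adding a vertex to an independent set.

infixl 6 _∪ₑ_

_∪ₑ_ : ∀ {n} → Subset n → Fin n → Subset n
I ∪ₑ w = I [ w ]≔ inside

w∈I∪w : ∀ {n} (I : Subset n) w → w ∈ I ∪ₑ w
w∈I∪w = []≔-updates

∈-∪⁺ : ∀ {n} {I : Subset n} {u} w → u ∈ I → u ∈ I ∪ₑ w
∈-∪⁺ {I = I} {u} w u∈I with u ≟ w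
... | yes refl = w∈I∪w I u
... | no  u≢w  = []≔-minimal I u w u≢w u∈I

∈-∪⁻ : ∀ {n} {I : Subset n} {u w} → u ≢ w → u ∈ I ∪ₑ w → u ∈ I
∈-∪⁻ {I = I} {u} u≢w u∈ = lookup⇒[]= u I (trans (sym (lookup∘update′ u≢w I inside)) ([]=⇒lookup u∈))

∣I∪w∣ : ∀ {n} {I : Subset n} {w} → w ∉ I → ∣ I ∪ₑ w ∣ ≡ suc ∣ I ∣
∣I∪w∣ {I = outside ∷ I} {zero}  w∉I = refl
∣I∪w∣ {I = inside  ∷ I} {zero}  w∉I = contradiction here w∉I
∣I∪w∣ {I = outside ∷ I} {suc w} w∉I = ∣I∪w∣ (w∉I ∘ there)
∣I∪w∣ {I = inside  ∷ I} {suc w} w∉I = cong suc (∣I∪w∣ (w∉I ∘ there))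

∈-allSubsets : ∀ {n} (I : Subset n) → I ∈ˡ allSubsets n
∈-allSubsets []            = here refl
∈-allSubsets (outside ∷ I) = ∈-++⁺ˡ (∈-map⁺ (outside ∷_) (∈-allSubsets I))
∈-allSubsets (inside  ∷ I) = ∈-++⁺ʳ (map (outside ∷_) (allSubsets _)) (∈-map⁺ (inside ∷_) (∈-allSubsets I))

-- Exchanging `u` and `u′` gives the reverse inclusion, so neighbours of a common vertex have equal
-- neighbourhoods. This is the combinatorial form of the equality case.
TwinNeighbours : ∀ {n} → Graph n → Set
TwinNeighbours G = ∀ {v u u′ w} → Adj G v u → Adj G v u′ → Adj G u w → Adj G u′ w

module _ {n} (G : Graph n) where

  ∪-independent⁻ : ∀ {I w} → Independent G (I ∪ₑ w) → Independent G I
  ∪-independent⁻ {w = w} ind u v u∈I v∈I = ind u v (∈-∪⁺ w u∈I) (∈-∪⁺ w v∈I)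

  ∪-independent⁺ : ∀ {I w} → Independent G I → (∀ u → u ∈ I → ¬ Adj G w u) → Independent G (I ∪ₑ w)
  ∪-independent⁺ {w = w} ind ¬adj u v u∈ v∈ u~v with u ≟ w | v ≟ w
  ... | yes refl | yes refl = adj-irrefl G refl u~v
  ... | yes refl | no  v≢w  = ¬adj v (∈-∪⁻ v≢w v∈) u~v
  ... | no  u≢w  | yes refl = ¬adj u (∈-∪⁻ u≢w u∈) (adj-sym G u~v)
  ... | no  u≢w  | no  v≢w  = ind u v (∈-∪⁻ u≢w u∈) (∈-∪⁻ v≢w v∈) u~v

  Avoids : (ℕ → Fin n) → ℕ → Subset n → Set
  Avoids e zero    I = ⊤
  Avoids e (suc k) I = Avoids e k I × e k ∉ I

  avoids? : ∀ e k I → Dec (Avoids e k I)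
  avoids? e zero    I = yes tt
  avoids? e (suc k) I = avoids? e k I ×-dec ¬? (e k ∈? I)

  avoids⁻ : ∀ {e I} k → Avoids e k I → ∀ {i} → i ℕ.< k → e i ∉ I
  avoids⁻ (suc k) (av , ek∉I) {i} i<1+k with ℕₚ.m≤n⇒m<n∨m≡n (ℕ.s≤s⁻¹ i<1+k)
  ... | inj₁ i<k  = avoids⁻ k av i<k
  ... | inj₂ refl = ek∉I

  avoids⁺ : ∀ {e I} k → (∀ {i} → i ℕ.< k → e i ∉ I) → Avoids e k I
  avoids⁺ zero    e∉I = tt
  avoids⁺ (suc k) e∉I = avoids⁺ k (e∉I ∘ ℕₚ.m<n⇒m<1+n) , e∉I (ℕₚ.n<1+n k)

  -- The set may contain `v` itself; for an independent set that already implies the condition.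
  Uncovered : Fin n → Subset n → Set
  Uncovered v I = ∀ u → Adj G v u → u ∉ I

  uncovered? : ∀ v I → Dec (Uncovered v I)
  uncovered? v I = all? λ u → adj? G v u →-dec ¬? (u ∈? I)

-- Neighbourhoods in a regular graph as cycles.

neighbours : ∀ {n} → Graph n → Fin n → List (Fin n)
neighbours {n} G v = filter (adj? G v) (allFin n)

module Neighbourhoods {n} (G : Graph n) {d} .{{_ : NonZero d}} (regular : Regular d G) where

  neighbourCycle : ∀ v → CyclicEnumeration d (neighbours G v)
  neighbourCycle v = cyclicEnumeration (filter⁺ (adj? G v) (allFin⁺ n)) (regular v)

  module Cycle v = CyclicEnumeration (neighbourCycle v)
  open Cycle using (at)

  adj-at : ∀ v i → Adj G v (at v i)
  adj-at v i = proj₂ (∈-filter⁻ (adj? G v) {xs = allFin n} (Cycle.at∈L v i))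

  adj⇒at : ∀ v s {u} → Adj G v u → ∃[ i ] i ℕ.< d × at v (s ℕ.+ i) ≡ u
  adj⇒at v s v~u = Cycle.∈⇒at v s (∈-filter⁺ (adj? G v) (∈-allFin _) v~u)

-- Weights of families of independent sets.

module Weights {c ℓ₁ ℓ₂} (ℝ : Reals c ℓ₁ ℓ₂) {n} (G : Graph n)
  {x : Reals.Carrier ℝ} (x>0 : Reals._<_ ℝ (Reals.0# ℝ) x) where

  open Reals ℝ renaming (refl to ≈-refl; sym to ≈-sym; trans to ≈-trans; reflexive to ≈-reflexive)
  open HardCore ℝ
  open Ordered ℝ
  open CommutativeRing commutativeRing using (commutativeSemiring)
  open NatCoefficients commutativeSemiring using (solve; _:=_; _:+_; _:*_; con)
  open SetoidReasoning setoid
  open OrderLike ≼-orderLike using () renaming (∼-resp to ≼-resp; *-mono to ≼-*-mono)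

  private
    S = allSubsets n

  -- This is `Z` times the hard-core probability of `φ`. The sum runs over all subsets, with
  -- independence as part of the indicator, so that `∑-toggle` applies.
  W : {φ : Subset n → Set} → (∀ I → Dec (φ I)) → Carrier
  W φ? = ∑ S (λ I → guard (does (independent? G I ×-dec φ? I)) (x ^ ∣ I ∣))

  W-⇔ : ∀ {φ ψ : Subset n → Set} (φ? : ∀ I → Dec (φ I)) (ψ? : ∀ I → Dec (ψ I)) →
        (∀ {I} → Independent G I → φ I → ψ I) → (∀ {I} → Independent G I → ψ I → φ I) → W φ? ≈ W ψ?
  W-⇔ φ? ψ? φ⇒ψ ψ⇒φ = ∑-cong S λ I → guard-⇔ (independent? G I ×-dec φ? I) (independent? G I ×-dec ψ? I)
    (λ (ind , φI) → ind , φ⇒ψ ind φI) (λ (ind , ψI) → ind , ψ⇒φ ind ψI)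

  W-split : ∀ {φ ψ : Subset n → Set} (φ? : ∀ I → Dec (φ I)) (ψ? : ∀ I → Dec (ψ I)) →
            W φ? ≈ W (λ I → φ? I ×-dec ψ? I) + W (λ I → φ? I ×-dec ¬? (ψ? I))
  W-split φ? ψ? = ≈-trans (∑-cong S split) (∑-+ S _ _)
    where
    split : ∀ I → _ ≈ _
    split I = ≈-trans (guard-split (does (independent? G I ×-dec φ? I)) (does (ψ? I)) (x ^ ∣ I ∣))
      (≈-reflexive (cong₂ (λ a b → guard a (x ^ ∣ I ∣) + guard b (x ^ ∣ I ∣))
        (∧-assoc (does (independent? G I)) _ _) (∧-assoc (does (independent? G I)) _ _)))

  -- Writing a set that contains `w` as `I ∪ₑ w` turns both weights to be compared into sums of
  -- `x * x ^ ∣ I ∣`, over the `Addable` and over the `Without` sets, so that they are compared term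
  -- by term.
  module Toggle {φ : Subset n → Set} (φ? : ∀ I → Dec (φ I)) (w : Fin n) where

    Addable : Subset n → Set
    Addable I = w ∉ I × Independent G (I ∪ₑ w) × φ (I ∪ₑ w)

    Without : Subset n → Set
    Without I = w ∉ I × Independent G I × φ I

    addable? : ∀ I → Dec (Addable I)
    addable? I = ¬? (w ∈? I) ×-dec (independent? G (I ∪ₑ w) ×-dec φ? (I ∪ₑ w))

    without? : ∀ I → Dec (Without I)
    without? I = ¬? (w ∈? I) ×-dec (independent? G I ×-dec φ? I)

    W-with : W (λ I → φ? I ×-dec (w ∈? I)) ≈ ∑ S (λ I → guard (does (addable? I)) (x * x ^ ∣ I ∣))
    W-with = begin
      W (λ I → φ? I ×-dec (w ∈? I))
        ≈⟨ ∑-cong S (λ I → ≈-reflexive (rearrange (does (independent? G I)) (does (φ? I)) (does (w ∈? I)) _)) ⟩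
      ∑ S (λ I → guard (does (w ∈? I)) (f I))
        ≈⟨ ∑-toggle w f ⟩
      ∑ S (λ I → guard (not (does (w ∈? I))) (f (I ∪ₑ w)))
        ≈⟨ ∑-cong S grow ⟩
      ∑ S (λ I → guard (does (addable? I)) (x * x ^ ∣ I ∣)) ∎
      where
      f : Subset n → Carrier
      f I = guard (does (independent? G I ×-dec φ? I)) (x ^ ∣ I ∣)

      rearrange : ∀ a b c y → guard (a ∧ (b ∧ c)) y ≡ guard c (guard (a ∧ b) y)
      rearrange true  true  c     y = refl
      rearrange true  false true  y = refl
      rearrange true  false false y = refl
      rearrange false b     true  y = refl
      rearrange false b     false y = refl

      grow : ∀ I → guard (not (does (w ∈? I))) (f (I ∪ₑ w)) ≈ guard (does (addable? I)) (x * x ^ ∣ I ∣)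
      grow I with w ∈? I
      ... | yes _   = ≈-refl
      ... | no  w∉I = guard-cong (does (independent? G (I ∪ₑ w) ×-dec φ? (I ∪ₑ w)))
        (≈-reflexive (cong (x ^_) (∣I∪w∣ w∉I)))

    W-without : x * W (λ I → φ? I ×-dec ¬? (w ∈? I)) ≈ ∑ S (λ I → guard (does (without? I)) (x * x ^ ∣ I ∣))
    W-without = ≈-trans (≈-sym (∑-*ˡ S x _)) (∑-cong S λ I →
      ≈-trans (guard-* (does (independent? G I ×-dec (φ? I ×-dec ¬? (w ∈? I)))) x _)
        (guard-⇔ (independent? G I ×-dec (φ? I ×-dec ¬? (w ∈? I))) (without? I)
          (λ (ind , φI , w∉I) → w∉I , ind , φI) (λ (w∉I , ind , φI) → ind , φI , w∉I)))

    module _ (φ-∪⁻ : ∀ {I} → w ∉ I → φ (I ∪ₑ w) → φ I) where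

      addable⇒without : ∀ {I} → Addable I → Without I
      addable⇒without (w∉I , ind , φI∪w) = w∉I , ∪-independent⁻ G ind , φ-∪⁻ w∉I φI∪w

      termwise : ∀ I → guard (does (addable? I)) (x * x ^ ∣ I ∣) ≼ guard (does (without? I)) (x * x ^ ∣ I ∣)
      termwise I = guard-⇒ (addable? I) (without? I) (^-pos (suc ∣ I ∣) x>0) addable⇒without

      -- Independence survives the removal of `w`, and so does `φ` by `φ-∪⁻`; hence every `Addable`
      -- set is `Without`.
      toggle-≼ : W (λ I → φ? I ×-dec (w ∈? I)) ≼ x * W (λ I → φ? I ×-dec ¬? (w ∈? I))
      toggle-≼ = ≼-resp (≈-sym W-with) (≈-sym W-without) (∑-mono-≼ S termwise)

      toggle-≈ : (∀ {I} → Without I → Addable I) →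
                 W (λ I → φ? I ×-dec (w ∈? I)) ≈ x * W (λ I → φ? I ×-dec ¬? (w ∈? I))
      toggle-≈ without⇒addable = ≈-trans W-with (≈-trans
        (∑-cong S λ I → guard-⇔ (addable? I) (without? I) addable⇒without without⇒addable) (≈-sym W-without))

      -- All terms have positive weight, so a single `Without` set that is not `Addable` would make
      -- the inequality strict.
      toggle-≈⇒ : W (λ I → φ? I ×-dec (w ∈? I)) ≈ x * W (λ I → φ? I ×-dec ¬? (w ∈? I)) →
                  ∀ {I} → Without I → Addable I
      toggle-≈⇒ eq {I} = guard-≈⇒ (addable? I) (without? I) (^-pos (suc ∣ I ∣) x>0)
        (∑-equal S termwise (≈-trans (≈-sym W-with) (≈-trans eq W-without)) (∈-allSubsets I))

  q : Carrier
  q = 1# + x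

  q>0 : 0# < q
  q>0 = +-pos 1>0 x>0

  Z : Carrier
  Z = W (λ _ → yes tt)

  X Y : Fin n → Carrier
  X v = W (v ∈?_)
  Y v = W (uncovered? G v)

  qX≈xY : ∀ v → q * X v ≈ x * Y v
  qX≈xY v = begin
    q * X v
      ≈⟨ distribʳ _ _ _ ⟩
    1# * X v + x * X v
      -- Toggling `v` accounts for `x` times the part of `Y v` without `v`; the summand `x * X v`
      -- supplies the part with `v`.
      ≈⟨ +-congʳ (≈-trans (*-identityˡ _) (≈-trans X≈ (toggle-≈ φ-∪⁻ without⇒addable))) ⟩
    x * W (λ I → uncovered? G v I ×-dec ¬? (v ∈? I)) + x * X v
      ≈⟨ ≈-trans (+-congˡ (*-congˡ X≈)) (≈-sym (distribˡ _ _ _)) ⟩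
    x * (W (λ I → uncovered? G v I ×-dec ¬? (v ∈? I)) + W (λ I → uncovered? G v I ×-dec (v ∈? I)))
      ≈⟨ *-congˡ (≈-trans (+-comm _ _) (≈-sym (W-split (uncovered? G v) (v ∈?_)))) ⟩
    x * Y v ∎
    where
    open Toggle (uncovered? G v) v

    φ-∪⁻ : ∀ {I} → v ∉ I → Uncovered G v (I ∪ₑ v) → Uncovered G v I
    φ-∪⁻ _ unc u v~u = unc u v~u ∘ ∈-∪⁺ v

    without⇒addable : ∀ {I} → Without I → Addable I
    without⇒addable (v∉I , ind , unc) = v∉I , ∪-independent⁺ G ind (λ u u∈I v~u → unc u v~u u∈I) ,
      λ u v~u u∈ → unc u v~u (∈-∪⁻ (λ u≡v → adj-irrefl G (sym u≡v) v~u) u∈)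

    X≈ : X v ≈ W (λ I → uncovered? G v I ×-dec (v ∈? I))
    X≈ = W-⇔ (v ∈?_) (λ I → uncovered? G v I ×-dec (v ∈? I))
      (λ ind v∈I → (λ u v~u u∈I → ind v u v∈I u∈I v~u) , v∈I) (λ _ → proj₂)

  -- The first occupied vertex of a sequence.

  FirstAt : (ℕ → Fin n) → ℕ → Fin n → Carrier
  FirstAt e k u = W (λ I → avoids? G e k I ×-dec (u ∈? I))

  H : (ℕ → Fin n) → ℕ → Carrier
  H e k = ∑ (downFrom k) (λ j → FirstAt e j (e j))

  Z≈avoided+H : ∀ e k → Z ≈ W (avoids? G e k) + H e k
  Z≈avoided+H e zero    = ≈-sym (+-identityʳ _)
  Z≈avoided+H e (suc k) = ≈-trans (Z≈avoided+H e k)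
    (≈-trans (+-congʳ (W-split (avoids? G e k) (e k ∈?_)))
      (solve 3 (λ a b c → (a :+ b) :+ c := b :+ (a :+ c)) ≈-refl _ _ _))

  module Step (e : ℕ → Fin n) (k : ℕ) {u : Fin n} where

    φ? : ∀ I → Dec (Avoids G e k I × u ∈ I)
    φ? I = avoids? G e k I ×-dec (u ∈? I)

    open Toggle φ? (e k) public

    φ-∪⁻ : u ≢ e k → ∀ {I} → e k ∉ I → Avoids G e k (I ∪ₑ e k) × u ∈ I ∪ₑ e k → Avoids G e k I × u ∈ I
    φ-∪⁻ u≢ek _ (av , u∈) = avoids⁺ G k (λ i<k → avoids⁻ G k av i<k ∘ ∈-∪⁺ (e k)) , ∈-∪⁻ u≢ek u∈

    split : FirstAt e k u ≈ W (λ I → φ? I ×-dec (e k ∈? I)) + W (λ I → φ? I ×-dec ¬? (e k ∈? I))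
    split = W-split φ? (e k ∈?_)

    next : FirstAt e (suc k) u ≈ W (λ I → φ? I ×-dec ¬? (e k ∈? I))
    next = W-⇔ (λ I → avoids? G e (suc k) I ×-dec (u ∈? I)) (λ I → φ? I ×-dec ¬? (e k ∈? I))
      (λ _ ((av , ek∉I) , u∈I) → (av , u∈I) , ek∉I) (λ _ ((av , u∈I) , ek∉I) → (av , ek∉I) , u∈I)

    q*next : q * FirstAt e (suc k) u ≈
             x * W (λ I → φ? I ×-dec ¬? (e k ∈? I)) + W (λ I → φ? I ×-dec ¬? (e k ∈? I))
    q*next = ≈-trans (*-congˡ next) (≈-trans (distribʳ _ _ _) (≈-trans (+-congʳ (*-identityˡ _)) (+-comm _ _)))

  module _ {ℓ} {_∼_ : Rel Carrier ℓ} (O : OrderLike _∼_) where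
    open OrderLike O

    -- The vertex `u` stays fixed while the avoided stretch grows. Splitting by `e k`, the part with
    -- `e k` is compared with `x` times the part without it, and the two together with `q` times the
    -- latter, which is `FirstAt e (suc k) u`.
    toggles⇒X∼q^k*FirstAt : ∀ e u k →
      (∀ {i} → i ℕ.< k → let open Step e i {u} using (φ?) in
        W (λ I → φ? I ×-dec (e i ∈? I)) ∼ (x * W (λ I → φ? I ×-dec ¬? (e i ∈? I)))) →
      X u ∼ (q ^ k * FirstAt e k u)
    toggles⇒X∼q^k*FirstAt e u zero    _      = ≈⇒∼ (≈-trans
      (W-⇔ (u ∈?_) (λ I → avoids? G e 0 I ×-dec (u ∈? I)) (λ _ u∈I → tt , u∈I) (λ _ → proj₂))
      (≈-sym (*-identityˡ _)))
    toggles⇒X∼q^k*FirstAt e u (suc k) toggle = ∼-trans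
      (toggles⇒X∼q^k*FirstAt e u k (toggle ∘ ℕₚ.m<n⇒m<1+n))
      (∼-resp ≈-refl (solve 3 (λ p q f → p :* (q :* f) := (q :* p) :* f) ≈-refl _ _ _)
        (*-mono (^-pos k q>0) (∼-resp (≈-sym split) (≈-sym q*next) (+-mono (toggle (ℕₚ.n<1+n k)) (≈⇒∼ ≈-refl)))))
      where open Step e k {u}

  X≼q^k*FirstAt : ∀ e k u → (∀ {i} → i ℕ.< k → u ≢ e i) → X u ≼ q ^ k * FirstAt e k u
  X≼q^k*FirstAt e k u u∉e = toggles⇒X∼q^k*FirstAt ≼-orderLike e u k
    λ {i} i<k → Step.toggle-≼ e i (Step.φ-∪⁻ e i (u∉e i<k))

  -- A set containing `u` has no neighbour of `e i`, since these are all neighbours of `u`; so `e i`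
  -- can always be added. Distinctness keeps the earlier `e j` avoided.
  X≈q^k*FirstAt : ∀ e k u → (∀ {i} → i ℕ.< k → u ≢ e i) → (∀ {i j} → i ℕ.< j → j ℕ.< k → e i ≢ e j) →
                  (∀ {i w} → i ℕ.< k → Adj G (e i) w → Adj G u w) → X u ≈ q ^ k * FirstAt e k u
  X≈q^k*FirstAt e k u u∉e distinct twin = toggles⇒X∼q^k*FirstAt ≈-orderLike e u k
    λ {i} i<k → Step.toggle-≈ e i (Step.φ-∪⁻ e i (u∉e i<k)) λ (ei∉I , ind , av , u∈I) →
      ei∉I , ∪-independent⁺ G ind (λ w w∈I ei~w → ind u w u∈I w∈I (twin i<k ei~w)) ,
      avoids⁺ G i (λ j<i → avoids⁻ G i av j<i ∘ ∈-∪⁻ (distinct j<i i<k)) , ∈-∪⁺ (e i) u∈I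

  X≈q*FirstAt⇒twin : ∀ e {u} → u ≢ e 0 → X u ≈ q * FirstAt e 1 u → ∀ {w} → Adj G (e 0) w → Adj G u w
  X≈q*FirstAt⇒twin e {u} u≢e0 eq {w} e0~w with adj? G u w
  ... | yes u~w = u~w
  ... | no ¬u~w = contradiction e0~w (proj₁ (proj₂ addable) (e 0) w (w∈I∪w I (e 0)) (∈-∪⁺ (e 0) (w∈I∪w _ w)))
    where
    open Step e 0 {u}

    -- If `u` and `w` are not adjacent, {u, w} is an independent set to which `e 0` cannot be added,
    -- being adjacent to `w`; equality would make it `Addable`.
    I = ⊥ ∪ₑ u ∪ₑ w

    I-elements : ∀ {z} → z ∈ I → z ≡ u ⊎ z ≡ w
    I-elements {z} z∈I with z ≟ w | z ≟ u
    ... | yes z≡w | _       = inj₂ z≡w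
    ... | no  _   | yes z≡u = inj₁ z≡u
    ... | no  z≢w | no  z≢u = contradiction (∈-∪⁻ z≢u (∈-∪⁻ z≢w z∈I)) ∉⊥

    independent : Independent G I
    independent a b a∈I b∈I a~b with I-elements a∈I | I-elements b∈I
    ... | inj₁ refl | inj₁ refl = adj-irrefl G refl a~b
    ... | inj₁ refl | inj₂ refl = ¬u~w a~b
    ... | inj₂ refl | inj₁ refl = ¬u~w (adj-sym G a~b)
    ... | inj₂ refl | inj₂ refl = adj-irrefl G refl a~b

    e0∉I : e 0 ∉ I
    e0∉I e0∈I with I-elements e0∈I
    ... | inj₁ e0≡u = u≢e0 (sym e0≡u)
    ... | inj₂ refl = adj-irrefl G refl e0~w

    toggled : W (λ I → φ? I ×-dec (e 0 ∈? I)) ≈ x * W (λ I → φ? I ×-dec ¬? (e 0 ∈? I))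
    -- The part without `e 0` occurs on both sides, so equality passes to the other summands.
    toggled = +-equalˡ (toggle-≼ (φ-∪⁻ u≢e0)) (inj₂ ≈-refl)
      (≈-trans (≈-sym split) (≈-trans (W-⇔ φ? (u ∈?_) (λ _ → proj₂) (λ _ u∈I → tt , u∈I)) (≈-trans eq q*next)))

    addable : Addable I
    addable = toggle-≈⇒ (φ-∪⁻ u≢e0) toggled (e0∉I , independent , tt , ∈-∪⁺ w (w∈I∪w _ u))

  -- Geometric sums and Horner sums along a sequence.

  geo : ℕ → Carrier
  geo zero    = 0#
  geo (suc k) = q * geo k + 1#

  -- Here `geo k` is 1 + q + ... + q^(k-1), and `x` is q - 1: the geometric sum formula, free of
  -- subtraction and division.
  x*geo+1≈q^ : ∀ k → x * geo k + 1# ≈ q ^ k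
  x*geo+1≈q^ zero    = ≈-trans (+-congʳ (zeroʳ x)) (+-identityˡ 1#)
  x*geo+1≈q^ (suc k) = ≈-trans
    (solve 2 (λ x g → x :* ((con 1 :+ x) :* g :+ con 1) :+ con 1 := (con 1 :+ x) :* (x :* g :+ con 1)) ≈-refl x (geo k))
    (*-congˡ (x*geo+1≈q^ k))

  -- Horner's scheme for ∑_{j<k} q^(k-1-j) X (e j).
  horner : (ℕ → Fin n) → ℕ → Carrier
  horner e zero    = 0#
  horner e (suc k) = q * horner e k + X (e k)

  horner-step : ∀ e k → q ^ suc k * H e (suc k) ≈ q * (q ^ k * H e k) + q * (q ^ k * FirstAt e k (e k))
  horner-step e k = solve 4 (λ q p f h → (q :* p) :* (f :+ h) := q :* (p :* h) :+ q :* (p :* f)) ≈-refl _ _ _ _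

  module _ {ℓ} {_∼_ : Rel Carrier ℓ} (O : OrderLike _∼_) where
    open OrderLike O

    -- The left side is ∑_{j<k} q^(k-j) X (e j); the factor q^(k-j) raises the power of `q` in the
    -- j-th hypothesis to the common `q ^ k`. Horner's scheme does this one factor `q` at a time.
    horner∼H : ∀ e k → (∀ {j} → j ℕ.< k → X (e j) ∼ (q ^ j * FirstAt e j (e j))) →
               (q * horner e k) ∼ (q ^ k * H e k)
    horner∼H e zero    _    = ≈⇒∼ (≈-trans (zeroʳ q) (≈-sym (zeroʳ _)))
    horner∼H e (suc k) step = ∼-resp (≈-sym (distribˡ _ _ _)) (≈-sym (horner-step e k))
      (+-mono (*-mono q>0 (horner∼H e k (step ∘ ℕₚ.m<n⇒m<1+n))) (*-mono q>0 (step (ℕₚ.n<1+n k))))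

  -- Equality of the sums forces equality of the last summand and of the rest, to which the
  -- induction applies.
  horner≈H⇒ : ∀ e k → (∀ {j} → j ℕ.< k → X (e j) ≼ q ^ j * FirstAt e j (e j)) →
              q * horner e k ≈ q ^ k * H e k → ∀ {j} → j ℕ.< k → X (e j) ≈ q ^ j * FirstAt e j (e j)
  horner≈H⇒ e (suc k) step eq {j} j<1+k with ℕₚ.m≤n⇒m<n∨m≡n (ℕ.s≤s⁻¹ j<1+k)
  ... | inj₁ j<k  = horner≈H⇒ e k (step ∘ ℕₚ.m<n⇒m<1+n) (*-cancel-≈ q>0 (+-equalˡ rest≼ last≼ eq′)) j<k
    where
    rest≼ = ≼-*-mono q>0 (horner∼H ≼-orderLike e k (step ∘ ℕₚ.m<n⇒m<1+n))
    last≼ = ≼-*-mono q>0 (step (ℕₚ.n<1+n k))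
    eq′   = ≈-trans (≈-sym (distribˡ _ _ _)) (≈-trans eq (horner-step e k))
  ... | inj₂ refl = *-cancel-≈ q>0 (+-equalʳ rest≼ last≼ eq′)
    where
    rest≼ = ≼-*-mono q>0 (horner∼H ≼-orderLike e k (step ∘ ℕₚ.m<n⇒m<1+n))
    last≼ = ≼-*-mono q>0 (step (ℕₚ.n<1+n k))
    eq′   = ≈-trans (≈-sym (distribˡ _ _ _)) (≈-trans eq (horner-step e k))

-- Averaging over rotations and over vertices.

module Averages {c ℓ₁ ℓ₂} (ℝ : Reals c ℓ₁ ℓ₂) {n} (G : Graph n)
  {x : Reals.Carrier ℝ} (x>0 : Reals._<_ ℝ (Reals.0# ℝ) x)
  {d} .{{_ : NonZero d}} (regular : Regular d G) where

  open Reals ℝ renaming (refl to ≈-refl; sym to ≈-sym; trans to ≈-trans; reflexive to ≈-reflexive)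
  open HardCore ℝ
  open Ordered ℝ
  open Weights ℝ G x>0
  open CommutativeRing commutativeRing using (commutativeSemiring; +-abelianGroup)
  open NatCoefficients commutativeSemiring using (solve; _:=_; _:+_; _:*_; con)
  open AbelianGroupProperties +-abelianGroup using (∙-cancelʳ)
  open SetoidReasoning setoid
  open Neighbourhoods G regular
  open Cycle using (at)

  from : Fin n → ℕ → ℕ → Fin n
  from v s i = at v (s ℕ.+ i)

  -- Any `d` consecutive terms of the cycle exhaust the neighbourhood of `v`.
  avoided≈Y : ∀ v s → W (avoids? G (from v s) d) ≈ Y v
  avoided≈Y v s = W-⇔ (avoids? G (from v s) d) (uncovered? G v)
    (λ {I} _ av u v~u → let i , i<d , eq = adj⇒at v s v~u in subst (_∉ I) eq (avoids⁻ G d av i<d))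
    (λ _ unc → avoids⁺ G d λ {i} _ → unc _ (adj-at v (s ℕ.+ i)))

  d̂ n̂ A : Carrier
  d̂ = d · 1#
  n̂ = n · 1#
  A = ∑ (allFin n) X

  E : Fin n → Carrier
  E v = ∑ (neighbours G v) X

  ∑X∘at≈E : ∀ v → ∑ (downFrom d) (X ∘ at v) ≈ E v
  ∑X∘at≈E v = subst (λ k → ∑ (downFrom k) (X ∘ at v) ≈ E v) (Cycle.length≡d v)
    (∑-lookup (neighbours G v) (at v) X (Cycle.at≡lookup v))

  -- At each fixed position, the rotations put every neighbour there exactly once and contribute
  -- `E v`; only the powers of `q` remain to be summed.
  ∑-horner : ∀ v k → ∑ (downFrom d) (λ s → horner (from v s) k) ≈ geo k * E v
  ∑-horner v zero    = ≈-trans (∑-0 (downFrom d)) (≈-sym (zeroˡ _))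
  ∑-horner v (suc k) = begin
    ∑ (downFrom d) (λ s → q * horner (from v s) k + X (from v s k))
      ≈⟨ ∑-+ (downFrom d) _ _ ⟩
    ∑ (downFrom d) (λ s → q * horner (from v s) k) + ∑ (downFrom d) (λ s → X (at v (s ℕ.+ k)))
      ≈⟨ +-cong (≈-trans (∑-*ˡ (downFrom d) q _) (*-congˡ (∑-horner v k)))
           (≈-trans (∑-shift (X ∘ at v) (λ i → ≈-reflexive (cong X (Cycle.periodic v i))) k) (∑X∘at≈E v)) ⟩
    q * (geo k * E v) + E v
      ≈⟨ solve 3 (λ q g e → q :* (g :* e) :+ e := (q :* g :+ con 1) :* e) ≈-refl q (geo k) (E v) ⟩
    geo (suc k) * E v ∎

  ∑-E : ∑ (allFin n) E ≈ d̂ * A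
  ∑-E = begin
    ∑ V E
      ≈⟨ ∑-cong V (λ v → ∑-filter (adj? G v) V X) ⟩
    ∑ V (λ v → ∑ V (λ u → guard (does (adj? G v u)) (X u)))
      ≈⟨ ∑-swap V V _ ⟩
    ∑ V (λ u → ∑ V (λ v → guard (does (adj? G v u)) (X u)))
      ≈⟨ ∑-cong V (λ u → ∑-cong V λ v → guard-⇔ (adj? G v u) (adj? G u v) (adj-sym G) (adj-sym G)) ⟩
    ∑ V (λ u → ∑ V (λ v → guard (does (adj? G u v)) (X u)))
      ≈⟨ ∑-cong V (λ u → ∑-filter (adj? G u) V (const (X u))) ⟨
    ∑ V (λ u → ∑ (neighbours G u) (const (X u)))
      ≈⟨ ∑-cong V (λ u → ≈-trans (∑-const (neighbours G u) (X u)) (*-congʳ (≈-reflexive (cong (_· 1#) (regular u))))) ⟩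
    ∑ V (λ u → d̂ * X u)
      ≈⟨ ∑-*ˡ V d̂ X ⟩
    d̂ * A ∎
    where V = allFin n

  -- The term in `Y v` stands on this side so that no subtraction occurs and the other side,
  -- `ceiling`, is the same for all `v` and `s`.
  local : Fin n → ℕ → Carrier
  local v s = q * horner (from v s) d + q ^ d * Y v

  ceiling : Carrier
  ceiling = q ^ d * Z

  ceiling≈ : ∀ v s → ceiling ≈ q ^ d * H (from v s) d + q ^ d * Y v
  ceiling≈ v s = ≈-trans (*-congˡ (≈-trans (Z≈avoided+H (from v s) d) (+-congʳ (avoided≈Y v s))))
    (≈-trans (distribˡ _ _ _) (+-comm _ _))

  total : Carrier
  total = ∑ (allFin n) (λ v → ∑ (downFrom d) (local v))

  bound : Carrier
  bound = ∑ (allFin n) (λ v → ∑ (downFrom d) (const ceiling))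

  -- The factor `x` turns `x * Y v` into `q * X v` and produces `x * geo d`, that is, q^d - 1.
  x*∑local≈ : ∀ v → x * ∑ (downFrom d) (local v) ≈ (q * (x * geo d)) * E v + ((d̂ * q ^ d) * q) * X v
  x*∑local≈ v = begin
    x * ∑ (downFrom d) (local v)
      ≈⟨ *-congˡ (≈-trans (∑-+ (downFrom d) _ _) (+-cong
           (≈-trans (∑-*ˡ (downFrom d) q _) (*-congˡ (∑-horner v d)))
           (≈-trans (∑-const (downFrom d) _) (*-congʳ (≈-reflexive (cong (_· 1#) (length-downFrom d))))))) ⟩
    x * (q * (geo d * E v) + d̂ * (q ^ d * Y v))
      ≈⟨ solve 7 (λ x q g e d p y → x :* (q :* (g :* e) :+ d :* (p :* y)) := (q :* (x :* g)) :* e :+ (d :* p) :* (x :* y))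
           ≈-refl x q (geo d) (E v) d̂ (q ^ d) (Y v) ⟩
    (q * (x * geo d)) * E v + (d̂ * q ^ d) * (x * Y v)
      ≈⟨ +-congˡ (≈-trans (*-congˡ (≈-sym (qX≈xY v))) (≈-sym (*-assoc _ _ _))) ⟩
    (q * (x * geo d)) * E v + ((d̂ * q ^ d) * q) * X v ∎

  D : Carrier
  D = (1# + 1#) * q ^ d - 1#

  D≈ : x * geo d + q ^ d ≈ D
  D≈ = ∙-cancelʳ 1# _ _ (begin
    (x * geo d + q ^ d) + 1#   ≈⟨ solve 2 (λ g p → (g :+ p) :+ con 1 := (g :+ con 1) :+ p) ≈-refl (x * geo d) (q ^ d) ⟩
    (x * geo d + 1#) + q ^ d   ≈⟨ +-congʳ (x*geo+1≈q^ d) ⟩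
    q ^ d + q ^ d              ≈⟨ solve 1 (λ p → p :+ p := con 2 :* p) ≈-refl (q ^ d) ⟩
    (1# + 1#) * q ^ d          ≈⟨ +-identityʳ _ ⟨
    (1# + 1#) * q ^ d + 0#     ≈⟨ +-congˡ (-‿inverseˡ 1#) ⟨
    (1# + 1#) * q ^ d + (- 1# + 1#) ≈⟨ +-assoc _ _ _ ⟨
    D + 1#                     ∎)

  x*total≈ : x * total ≈ (d̂ * q) * (D * A)
  x*total≈ = begin
    x * total
      ≈⟨ ∑-*ˡ V x _ ⟨
    ∑ V (λ v → x * ∑ (downFrom d) (local v))
      ≈⟨ ∑-cong V x*∑local≈ ⟩
    ∑ V (λ v → (q * (x * geo d)) * E v + ((d̂ * q ^ d) * q) * X v)
      ≈⟨ ≈-trans (∑-+ V _ _) (+-cong (∑-*ˡ V _ E) (∑-*ˡ V _ X)) ⟩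
    (q * (x * geo d)) * ∑ V E + ((d̂ * q ^ d) * q) * A
      ≈⟨ +-congʳ (*-congˡ ∑-E) ⟩
    (q * (x * geo d)) * (d̂ * A) + ((d̂ * q ^ d) * q) * A
      ≈⟨ solve 5 (λ q g d p a → (q :* g) :* (d :* a) :+ ((d :* p) :* q) :* a := (d :* q) :* ((g :+ p) :* a))
           ≈-refl q (x * geo d) d̂ (q ^ d) A ⟩
    (d̂ * q) * ((x * geo d + q ^ d) * A)
      ≈⟨ *-congˡ (*-congʳ D≈) ⟩
    (d̂ * q) * (D * A) ∎
    where V = allFin n

  x*bound≈ : x * bound ≈ (d̂ * q) * ((x * q ^ pred d) * (n̂ * Z))
  x*bound≈ = begin
    x * bound
      ≈⟨ *-congˡ (≈-trans (∑-const (allFin n) _) (*-cong (≈-reflexive (cong (_· 1#) (length-tabulate {n = n} id)))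
           (≈-trans (∑-const (downFrom d) _) (*-congʳ (≈-reflexive (cong (_· 1#) (length-downFrom d))))))) ⟩
    x * (n̂ * (d̂ * (q ^ d * Z)))
      -- As `d` is positive, a factor `q` can be taken out, to match the factor `d̂ * q` of
      -- `x*total≈`.
      ≈⟨ *-congˡ (*-congˡ (*-congˡ (*-congʳ (≈-reflexive (cong (q ^_) (sym (ℕₚ.suc-pred d))))))) ⟩
    x * (n̂ * (d̂ * ((q * q ^ pred d) * Z)))
      ≈⟨ solve 6 (λ x n d q p z → x :* (n :* (d :* ((q :* p) :* z))) := (d :* q) :* ((x :* p) :* (n :* z)))
           ≈-refl x n̂ d̂ q (q ^ pred d) Z ⟩
    (d̂ * q) * ((x * q ^ pred d) * (n̂ * Z)) ∎

  -- The occupancy fraction and its bound.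

  module _ .{{_ : NonZero n}} where

    α β : Carrier
    α = occupancyFraction G x>0
    β = (x * q ^ pred d) ÷ D ⟨ 2[1+x]^d-1>0 d x>0 ⟩

    P≈Z : independencePoly G x ≈ Z
    P≈Z = ≈-trans (∑-filter (independent? G) (allSubsets n) _)
      (∑-cong (allSubsets n) λ I → ≈-reflexive (cong (λ b → guard b (x ^ ∣ I ∣)) (sym (∧-identityʳ _))))

    Pr*P≈X : ∀ v → Pr[ v ∈I] G x>0 * independencePoly G x ≈ X v
    Pr*P≈X v = begin
      ∑ L (Pr G x>0) * P
        ≈⟨ *-comm _ _ ⟩
      P * ∑ L (Pr G x>0)
        ≈⟨ ∑-*ˡ L P _ ⟨
      ∑ L (λ I → P * Pr G x>0 I)
        ≈⟨ ∑-cong L (λ I → ≈-trans (*-comm _ _) (÷-* _ (independencePoly-pos G x>0))) ⟩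
      ∑ L (λ I → x ^ ∣ I ∣)
        ≈⟨ ∑-filter (v ∈?_) (independentSets G) _ ⟩
      ∑ (independentSets G) (λ I → guard (does (v ∈? I)) (x ^ ∣ I ∣))
        ≈⟨ ∑-filter (independent? G) (allSubsets n) _ ⟩
      ∑ (allSubsets n) (λ I → guard (does (independent? G I)) (guard (does (v ∈? I)) (x ^ ∣ I ∣)))
        ≈⟨ ∑-cong (allSubsets n) (λ I → ≈-reflexive (guard-∧ (does (independent? G I)) _ _)) ⟩
      X v ∎
      where
      P = independencePoly G x
      L = filter (v ∈?_) (independentSets G)

    n̂Zα≈A : (n̂ * Z) * α ≈ A
    n̂Zα≈A = begin
      (n̂ * Z) * α
        ≈⟨ solve 3 (λ n z a → (n :* z) :* a := z :* (a :* n)) ≈-refl n̂ Z α ⟩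
      Z * (α * n̂)
        ≈⟨ *-cong (≈-sym P≈Z) (÷-* _ (·1-pos n)) ⟩
      independencePoly G x * ∑ (allFin n) (λ v → Pr[ v ∈I] G x>0)
        ≈⟨ ∑-*ˡ (allFin n) _ _ ⟨
      ∑ (allFin n) (λ v → independencePoly G x * Pr[ v ∈I] G x>0)
        ≈⟨ ∑-cong (allFin n) (λ v → ≈-trans (*-comm _ _) (Pr*P≈X v)) ⟩
      A ∎

    -- A common multiple of the denominators of `α` and `β`, with the factor `d̂ * q` that makes the
    -- products `x * total` and `x * bound`.
    scale : Carrier
    scale = (d̂ * q) * (D * (n̂ * Z))

    scale>0 : 0# < scale
    scale>0 = *-pos (*-pos (·1-pos d) q>0) (*-pos (2[1+x]^d-1>0 d x>0)
      (*-pos (·1-pos n) (<-respʳ-≈ P≈Z (independencePoly-pos G x>0))))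

    scale*α≈ : scale * α ≈ x * total
    scale*α≈ = ≈-trans (≈-trans
      (solve 4 (λ k d z a → (k :* (d :* z)) :* a := k :* (d :* (z :* a))) ≈-refl (d̂ * q) D (n̂ * Z) α)
      (*-congˡ (*-congˡ n̂Zα≈A))) (≈-sym x*total≈)

    scale*β≈ : scale * β ≈ x * bound
    scale*β≈ = ≈-trans (≈-trans
      (solve 4 (λ k d z a → (k :* (d :* z)) :* a := k :* ((a :* d) :* z)) ≈-refl (d̂ * q) D (n̂ * Z) β)
      (*-congˡ (*-congʳ (÷-* _ (2[1+x]^d-1>0 d x>0))))) (≈-sym x*bound≈)

    module _ {ℓ} {_∼_ : Rel Carrier ℓ} (O : OrderLike _∼_) where
      open OrderLike O

      α∼β : (∀ v s → local v s ∼ ceiling) → α ∼ β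
      α∼β local∼ceiling = *-cancel scale>0 (∼-resp (≈-sym scale*α≈) (≈-sym scale*β≈)
        (*-mono x>0 (∑-mono (allFin n) λ v → ∑-mono (downFrom d) (local∼ceiling v))))

      local∼ceiling : ∀ v s → (∀ {j} → j ℕ.< d → X (from v s j) ∼ (q ^ j * FirstAt (from v s) j (from v s j))) →
                      local v s ∼ ceiling
      local∼ceiling v s step = ∼-trans (+-mono (horner∼H O (from v s) d step) (≈⇒∼ ≈-refl))
        (≈⇒∼ (≈-sym (ceiling≈ v s)))

    first-≼ : ∀ v s {j} → j ℕ.< d → X (from v s j) ≼ q ^ j * FirstAt (from v s) j (from v s j)
    first-≼ v s {j} j<d = X≼q^k*FirstAt (from v s) j _ λ i<j → Cycle.at-distinct-shifted v s i<j j<d ∘ sym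

    local≼ceiling : ∀ v s → local v s ≼ ceiling
    local≼ceiling v s = local∼ceiling ≼-orderLike v s (first-≼ v s)

    α≼β : α ≼ β
    α≼β = α∼β ≼-orderLike local≼ceiling

    twins⇒α≈β : TwinNeighbours G → α ≈ β
    twins⇒α≈β twin = α∼β ≈-orderLike λ v s → local∼ceiling ≈-orderLike v s λ {j} j<d →
      X≈q^k*FirstAt (from v s) j _
        (λ i<j → Cycle.at-distinct-shifted v s i<j j<d ∘ sym)
        (λ i<j j<k → Cycle.at-distinct-shifted v s i<j (ℕₚ.<-trans j<k j<d))
        (λ {i} _ → twin (adj-at v (s ℕ.+ i)) (adj-at v (s ℕ.+ j)))

    -- From equality to twin neighbours.

    module _ (α≈β : α ≈ β) where

      -- The double sums agree and are ordered term by term, so `∑-equal` applies first over the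
      -- vertices and then over the rotations.
      local≈ceiling : ∀ v {s} → s ℕ.< d → local v s ≈ ceiling
      local≈ceiling v s<d = ∑-equal (downFrom d) (local≼ceiling v)
        (∑-equal (allFin n) (λ v → ∑-mono-≼ (downFrom d) (local≼ceiling v)) total≈bound (∈-allFin v))
        (∈-downFrom⁺ s<d)
        where
        total≈bound : total ≈ bound
        total≈bound = *-cancel-≈ x>0 (≈-trans (≈-sym scale*α≈) (≈-trans (*-congˡ α≈β) scale*β≈))

      first-≈ : ∀ v {s} → s ℕ.< d → ∀ {j} → j ℕ.< d →
                X (from v s j) ≈ q ^ j * FirstAt (from v s) j (from v s j)
      first-≈ v {s} s<d = horner≈H⇒ (from v s) d (first-≼ v s)
        (∙-cancelʳ (q ^ d * Y v) _ _ (≈-trans (local≈ceiling v s<d) (ceiling≈ v s)))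

      -- With the cycle started at `s`, the equality for `j = 1` compares `at v (suc s)` with the
      -- single avoided vertex `at v s`.
      successor-twin : ∀ v {s} → s ℕ.< d → ∀ {w} → Adj G (at v s) w → Adj G (at v (suc s)) w
      successor-twin v {s} s<d {w} s~w with ℕₚ.<-cmp 1 d
      ... | tri< 1<d _ _ = subst (λ i → Adj G (at v i) w) (ℕₚ.+-comm s 1)
        (X≈q*FirstAt⇒twin (from v s) (Cycle.at-distinct-shifted v s z<s 1<d ∘ sym)
          (≈-trans (first-≈ v s<d 1<d) (*-congʳ (*-identityʳ q)))
          (subst (λ i → Adj G (at v i) w) (sym (ℕₚ.+-identityʳ s)) s~w))
      -- With `d = 1` there is no index 1 below `d`, but the only neighbour is its own successor.
      ... | tri≈ _ refl _ = subst (λ u → Adj G u w) (sym (trans (cong (at v) (ℕₚ.+-comm 1 s)) (Cycle.periodic v s))) s~w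
      ... | tri> _ _ d<1 = contradiction (ℕₚ.≤-<-trans ℕ.z≤n s<d) (ℕₚ.≤⇒≯ (ℕ.s≤s⁻¹ d<1))

      later-twin : ∀ v {s} k → s ℕ.+ k ℕ.≤ d → ∀ {w} → Adj G (at v s) w → Adj G (at v (s ℕ.+ k)) w
      later-twin v {s} zero    _     {w} s~w = subst (λ i → Adj G (at v i) w) (sym (ℕₚ.+-identityʳ s)) s~w
      later-twin v {s} (suc k) s+k<d {w} s~w = subst (λ i → Adj G (at v i) w) (sym (ℕₚ.+-suc s k))
        (successor-twin v s+k<d′ (later-twin v k (ℕₚ.<⇒≤ s+k<d′) s~w))
        where
        s+k<d′ : s ℕ.+ k ℕ.< d
        s+k<d′ = ℕₚ.≤-trans (ℕₚ.≤-reflexive (sym (ℕₚ.+-suc s k))) s+k<d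

      α≈β⇒twins : TwinNeighbours G
      α≈β⇒twins {v} {w = w} v~u v~u′ u~w with adj⇒at v 0 v~u | adj⇒at v 0 v~u′
      -- Twins propagate forwards only: from `i` up to `d`, which is 0 again by periodicity, and
      -- from there up to `j`.
      ... | i , i<d , refl | j , j<d , refl = later-twin v j (ℕₚ.<⇒≤ j<d) (subst (λ u → Adj G u w) (Cycle.periodic v 0)
        (subst (λ i → Adj G (at v i) w) (ℕₚ.m+[n∸m]≡n (ℕₚ.<⇒≤ i<d))
          (later-twin v (d ℕ.∸ i) (ℕₚ.≤-reflexive (ℕₚ.m+[n∸m]≡n (ℕₚ.<⇒≤ i<d))) u~w)))

-- The complete bipartite graph has twin neighbours and is regular.

tabulate-+ : ∀ {A : Set} m {n} (f : Fin (m ℕ.+ n) → A) →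
             tabulate f ≡ tabulate (f ∘ (_↑ˡ n)) ++ tabulate (f ∘ (m ↑ʳ_))
tabulate-+ zero    f = refl
tabulate-+ (suc m) f = cong (f zero ∷_) (tabulate-+ m (f ∘ suc))

K-twins : ∀ d → TwinNeighbours (K d)
K-twins d {v} {u} {u′} {w} = twins (splitAt d v) (splitAt d u) (splitAt d u′) (splitAt d w)
  where
  twins : ∀ (a b b′ c : Fin d ⊎ Fin d) → Opposite a b → Opposite a b′ → Opposite b c → Opposite b′ c
  twins (inj₁ _) (inj₂ _) (inj₂ _) (inj₁ _) _ _ _ = tt
  twins (inj₂ _) (inj₁ _) (inj₁ _) (inj₂ _) _ _ _ = tt

K-regular : ∀ d → Regular d (K d)
K-regular d v = trans (cong (length ∘ filter (adj? (K d) v)) (tabulate-+ d id))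
  (trans (cong length (filter-++ (adj? (K d) v) lower upper))
    (trans (length-++ (filter (adj? (K d) v) lower)) (count (splitAt d v) refl)))
  where
  lower upper : List (Fin (d ℕ.+ d))
  lower = tabulate (_↑ˡ d)
  upper = tabulate (d ↑ʳ_)

  count : ∀ a → splitAt d v ≡ a → length (filter (adj? (K d) v) lower) ℕ.+ length (filter (adj? (K d) v) upper) ≡ d
  count (inj₁ i) eq = cong₂ ℕ._+_
    (cong length (filter-none (adj? (K d) v) (tabulate⁺ λ j →
      subst₂ (λ a b → ¬ Opposite a b) (sym eq) (sym (splitAt-↑ˡ d j d)) λ ())))
    (trans (cong length (filter-all (adj? (K d) v) (tabulate⁺ λ j →
        subst₂ Opposite (sym eq) (sym (splitAt-↑ʳ d d j)) tt)))
      (length-tabulate (d ↑ʳ_)))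
  count (inj₂ i) eq = trans (cong₂ ℕ._+_
    (trans (cong length (filter-all (adj? (K d) v) (tabulate⁺ λ j →
        subst₂ Opposite (sym eq) (sym (splitAt-↑ˡ d j d)) tt)))
      (length-tabulate (_↑ˡ d)))
    (cong length (filter-none (adj? (K d) v) (tabulate⁺ λ j →
      subst₂ (λ a b → ¬ Opposite a b) (sym eq) (sym (splitAt-↑ʳ d d j)) λ ()))))
    (ℕₚ.+-identityʳ d)

-- Graphs partitioned into closed copies of one graph.

record ClosedEmbedding {m n} (H : Graph m) (G : Graph n) : Set where
  field
    to        : Fin m → Fin n
    injective : ∀ {i j} → to i ≡ to j → i ≡ j
    adj⇔      : ∀ i j → Adj H i j ⇔ Adj G (to i) (to j)
    closed    : ∀ i {w} → Adj G (to i) w → ∃[ j ] to j ≡ w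

open ClosedEmbedding

module _ {m n} {H : Graph m} {G : Graph n} {k} (block : Fin k → ClosedEmbedding H G)
  (disjoint : ∀ {b c i j} → to (block b) i ≡ to (block c) j → b ≡ c)
  (covers : ∀ w → ∃[ b ] ∃[ i ] to (block b) i ≡ w) where

  -- No edge leaves the image of a closed embedding, so by disjointness adjacent vertices lie in the
  -- same block; inside a block, `adj⇔` decides.
  blocks⇒≅copies : G ≅ copies k H
  blocks⇒≅copies = record
    { bijection = mk↔ₛ′ position vertex (λ i → vertex-injective (vertex∘position (vertex i))) vertex∘position
    ; adj⇔adj   = λ u v → subst₂ (λ u′ v′ → Adj G u′ v′ ⇔ Adj (copies k H) (position u) (position v))
        (vertex∘position u) (vertex∘position v) (adj-vertex (position u) (position v))
    }
    where
    vertex : Fin (k ℕ.* m) → Fin n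
    vertex i = to (block (quotient m i)) (remainder {k} m i)

    position : Fin n → Fin (k ℕ.* m)
    position w = let b , i , _ = covers w in combine b i

    vertex∘position : ∀ w → vertex (position w) ≡ w
    vertex∘position w = let b , i , eq = covers w in
      trans (cong (λ (c , j) → to (block c) j) (remQuot-combine {k} b i)) eq

    vertex-injective : ∀ {i j} → vertex i ≡ vertex j → i ≡ j
    vertex-injective {i} {j} eq = trans (sym (combine-remQuot {k} m i))
      (trans (cong₂ combine same-block (same-vertex same-block eq)) (combine-remQuot {k} m j))
      where
      same-block : quotient m i ≡ quotient m j
      same-block = disjoint eq

      same-vertex : ∀ {b c i j} → b ≡ c → to (block b) i ≡ to (block c) j → i ≡ j
      same-vertex {b} refl = injective (block b)

    adj-vertex : ∀ i j → Adj G (vertex i) (vertex j) ⇔ Adj (copies k H) i j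
    adj-vertex i j = mk⇔
      (λ i~j → let same = disjoint (proj₂ (closed (block (quotient m i)) _ i~j)) in
         same , Equivalence.from (adj⇔ (block (quotient m i)) _ _)
           (subst (λ c → Adj G (vertex i) (to (block c) _)) (sym same) i~j))
      (λ (same , i~j) → subst (λ c → Adj G (vertex i) (to (block c) _)) same
         (Equivalence.to (adj⇔ (block (quotient m i)) _ _) i~j))

-- Decomposition of a regular graph with twin neighbours.

module _ {n} (G : Graph n) {d} .{{_ : NonZero d}} (regular : Regular d G) (twin : TwinNeighbours G) where

  open Neighbourhoods G regular
  open Cycle using (at)

  neighbour : Fin n → Fin d → Fin n
  neighbour v i = at v (toℕ i)

  neighbour-injective : ∀ v {i j} → neighbour v i ≡ neighbour v j → i ≡ j
  neighbour-injective v {i} {j} eq with ℕₚ.<-cmp (toℕ i) (toℕ j)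
  ... | tri< i<j _ _ = contradiction eq (Cycle.at-distinct v i<j (toℕ<n j))
  ... | tri≈ _ i≡j _ = toℕ-injective i≡j
  ... | tri> _ _ j<i = contradiction (sym eq) (Cycle.at-distinct v j<i (toℕ<n i))

  neighbour-onto : ∀ v {u} → Adj G v u → ∃[ i ] neighbour v i ≡ u
  neighbour-onto v v~u = let i , i<d , eq = adj⇒at v 0 v~u in
    fromℕ< i<d , trans (cong (at v) (toℕ-fromℕ< i<d)) eq

  -- Otherwise `b`, a neighbour of `a`, would by the twin property be a neighbour of `b` itself.
  neighbours-independent : ∀ {v a b} → Adj G v a → Adj G v b → ¬ Adj G a b
  neighbours-independent v~a v~b a~b = adj-irrefl G refl (twin v~a v~b a~b)

  module _ {v u} (v~u : Adj G v u) where

    side : Fin d ⊎ Fin d → Fin n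
    side (inj₁ i) = neighbour v i
    side (inj₂ i) = neighbour u i

    -- Since `u` is itself a neighbour of `v`, all neighbours of `v` share its neighbourhood.
    sides-adjacent : ∀ i j → Adj G (neighbour v i) (neighbour u j)
    sides-adjacent i j = twin v~u (adj-at v (toℕ i)) (adj-at u (toℕ j))

    side-injective : ∀ a b → side a ≡ side b → a ≡ b
    side-injective (inj₁ i) (inj₁ j) eq = cong inj₁ (neighbour-injective v eq)
    side-injective (inj₁ i) (inj₂ j) eq = contradiction (sides-adjacent i j) (adj-irrefl G eq)
    side-injective (inj₂ i) (inj₁ j) eq = contradiction (sides-adjacent j i) (adj-irrefl G (sym eq))
    side-injective (inj₂ i) (inj₂ j) eq = cong inj₂ (neighbour-injective u eq)

    side-adj : ∀ a b → Opposite a b ⇔ Adj G (side a) (side b)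
    side-adj (inj₁ i) (inj₁ j) = mk⇔ (λ ()) (neighbours-independent (adj-at v (toℕ i)) (adj-at v (toℕ j)))
    side-adj (inj₁ i) (inj₂ j) = mk⇔ (λ _ → sides-adjacent i j) _
    side-adj (inj₂ i) (inj₁ j) = mk⇔ (λ _ → adj-sym G (sides-adjacent j i)) _
    side-adj (inj₂ i) (inj₂ j) = mk⇔ (λ ()) (neighbours-independent (adj-at u (toℕ i)) (adj-at u (toℕ j)))

    side-closed : ∀ a {w} → Adj G (side a) w → ∃[ b ] side b ≡ w
    side-closed (inj₁ i) a~w =
      let j , eq = neighbour-onto u (twin (adj-at v (toℕ i)) v~u a~w) in inj₂ j , eq
    side-closed (inj₂ i) a~w =
      let j , eq = neighbour-onto v (twin (adj-at u (toℕ i)) (adj-sym G v~u) a~w) in inj₁ j , eq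

    K-embedding : ClosedEmbedding (K d) G
    K-embedding = record
      { to        = side ∘ splitAt d
      ; injective = λ {i} {j} eq → trans (sym (join-splitAt d d i))
          (trans (cong (join d d) (side-injective (splitAt d i) (splitAt d j) eq)) (join-splitAt d d j))
      ; adj⇔      = λ i j → side-adj (splitAt d i) (splitAt d j)
      ; closed    = λ i i~w → let b , eq = side-closed (splitAt d i) i~w in
          join d d b , trans (cong side (splitAt-join d d b)) eq
      }

    -- By closedness, `v` is reached in one step from its own neighbours and in two, through `u`,
    -- from those of `u`. So the block around an uncovered `v` misses all earlier blocks.
    meets⇒covers-v : ∀ {m} {H : Graph m} (f : ClosedEmbedding H G) a {i} → to f i ≡ side a → ∃[ j ] to f j ≡ v
    meets⇒covers-v f (inj₁ a) {i} eq = closed f i (subst (λ z → Adj G z v) (sym eq) (adj-sym G (adj-at v (toℕ a))))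
    meets⇒covers-v f (inj₂ a) {i} eq with closed f i (subst (λ z → Adj G z u) (sym eq) (adj-sym G (adj-at u (toℕ a))))
    ... | j , refl = closed f j (adj-sym G v~u)

  record Packing (k : ℕ) : Set where
    field
      block    : Fin k → ClosedEmbedding (K d) G
      disjoint : ∀ {b c i j} → to (block b) i ≡ to (block c) j → b ≡ c

  open Packing

  extend : ∀ {k} (p : Packing k) {v} → (∀ b i → to (block p b) i ≢ v) → Packing (suc k)
  extend p {v} uncovered = record { block = block′ ; disjoint = disjoint′ }
    where
    -- A neighbour exists because `d` is positive.
    v~u = adj-at v 0

    block′ : Fin _ → ClosedEmbedding (K d) G
    block′ zero    = K-embedding v~u
    block′ (suc b) = block p b

    disjoint′ : ∀ {b c i j} → to (block′ b) i ≡ to (block′ c) j → b ≡ c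
    disjoint′ {zero}  {zero}          eq = refl
    disjoint′ {suc b} {suc c}         eq = cong suc (disjoint p eq)
    disjoint′ {zero}  {suc c} {i}     eq =
      let j , eq′ = meets⇒covers-v v~u (block p c) (splitAt d i) (sym eq) in contradiction eq′ (uncovered c j)
    disjoint′ {suc b} {zero} {_} {j} eq =
      let i , eq′ = meets⇒covers-v v~u (block p b) (splitAt d j) eq in contradiction eq′ (uncovered b i)

  packing⇒k≤n : ∀ {k} → Packing k → k ℕ.≤ n
  packing⇒k≤n p = injective⇒≤ {f = λ b → to (block p b) first} (disjoint p)
    where first = join d d (inj₁ (fromℕ< (ℕ.>-nonZero⁻¹ d)))

  -- Each extension trades one unit of fuel for one block, which preserves `n < fuel + k`; without
  -- fuel there would be more disjoint blocks than vertices.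
  saturate : ∀ fuel {k} → n ℕ.< fuel ℕ.+ k → Packing k → ∃[ l ] G ≅ copies l (K d)
  saturate zero       n<k p = contradiction (packing⇒k≤n p) (ℕₚ.<⇒≱ n<k)
  saturate (suc fuel) {k} n<1+fuel+k p with all? (λ w → any? λ b → any? λ i → to (block p b) i ≟ w)
  ... | yes covers = k , blocks⇒≅copies (block p) (disjoint p) covers
  ... | no ¬covers = let v , ¬covered = ¬∀⟶∃¬ n _ (λ w → any? λ b → any? λ i → to (block p b) i ≟ w) ¬covers in
    saturate fuel (subst (n ℕ.<_) (sym (ℕₚ.+-suc fuel k)) n<1+fuel+k) (extend p λ b i eq → ¬covered (b , i , eq))

  twins⇒copies : ∃[ k ] G ≅ copies k (K d)
  twins⇒copies = saturate (suc n) (ℕₚ.m≤m+n (suc n) 0) (record { block = λ () ; disjoint = λ {} })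

theorem1 : ∀ {c ℓ₁ ℓ₂} (ℝ : Reals c ℓ₁ ℓ₂) →
    let open Reals ℝ
        open HardCore ℝ
    in
    ∀ (d : ℕ) .{{_ : NonZero d}} {n : ℕ} .{{_ : NonZero n}} (G : Graph n) → Regular d G →
    (∀ (x : Carrier) (x>0 : 0# < x) →
       occupancyFraction G x>0 ≤ occupancyFraction (K d) x>0 ×
       occupancyFraction (K d) x>0 ≈
         (x * (1# + x) ^ pred d) ÷ ((1# + 1#) * (1# + x) ^ d - 1#) ⟨ 2[1+x]^d-1>0 d x>0 ⟩) ×
    ((∃[ x ] ∃[ x>0 ] occupancyFraction G {x} x>0 ≈ occupancyFraction (K d) x>0) →
       ∃[ k ] G ≅ copies k (K d))
theorem1 ℝ d G regular =
  (λ x x>0 → ≼⇒≤ (∼-trans (Averages.α≼β ℝ G x>0 regular) (≈⇒∼ (≈-sym (αK≈β x>0)))) , αK≈β x>0) ,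
  (λ (x , x>0 , αG≈αK) → twins⇒copies G regular
    (Averages.α≈β⇒twins ℝ G x>0 regular (≈-trans αG≈αK (αK≈β x>0))))
  where
  open Reals ℝ using (_≈_; 0#; _<_) renaming (sym to ≈-sym; trans to ≈-trans)
  open Ordered ℝ
  open OrderLike ≼-orderLike

  -- The value `β` depends on `d` and `x` only, so what `K d` attains is also the bound for `G`.
  αK≈β : ∀ {x} (x>0 : 0# < x) → HardCore.occupancyFraction ℝ (K d) x>0 ≈ Averages.β ℝ (K d) x>0 (K-regular d)
  αK≈β x>0 = Averages.twins⇒α≈β ℝ (K d) x>0 (K-regular d) (K-twins d)
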